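{- Let $G=(V,A,s)$ be a flow graph. Consider Algorithm GD (Version 1) modified so that each $\mathit{transform}(u,v)$ is replaced by a plain contraction of $v$ into its current parent (Step 0 omitted) and every arc is deleted as soon as it is marked. Then for every choice of depth-first spanning tree, bottom-up numbering, and order of arc selections, the modified algorithm terminates and, for every vertex $w\ne s$, assigns to $d(w)$ the immediate dominator of $w$ in $G$.
   Context: A flow graph $G=(V,A,s)$ is a finite directed graph with start vertex $s$ from which every vertex is reachable; assume $n=|V|>1$, no arcs enter $s$, and $G$ has no multiple arcs and no loop arcs. A vertex $x$ dominates $y$ if every path from $s$ to $y$ contains $x$; the immediate dominator of $y\neq s$ is the unique dominator $d(y)\ne y$ of $y$ dominated by all dominators of $y$ other than $y$. A depth-first spanning tree is the tree of parent pointers produced by a depth-first search of $G$ from $s$. For the current spanning tree with parent function $p$, an arc $(x,w)$ is a tree arc if $x=p(w)$, forward if $x$ is a proper ancestor of $p(w)$, back if $x$ is a proper descendant of $w$, loop if $x=w$. Contracting $v$ into $p(v)$ replaces every arc end equal to $v$ by $p(v)$, deletes $v$, and makes the former children of $v$ children of $p(v)$; produced arcs inherit marks. For $u$ a proper ancestor of $v$, $\mathit{transform}(u,v)$ is: Step 0: for each arc from $v$ to a proper descendant $w\notin\{v,p(v)\}$ of $u$, add an unmarked arc $(p(u),w)$; Step 1: contract $v$ into $p(v)$. Algorithm GD (Version 1): choose a depth-first spanning tree $T$ with parent function $p$; number vertices $1,\dots,n$ with $x<p(x)$ for $x\ne s$; unmark all arcs; $\mathit{same}(x)=\{x\}$ for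 all $x$. For $u=1,\dots,n$: while some tree or forward arc $(u,v)$ is unmarked: mark it; if all arcs into $v$ are marked, then (if $u=p(v)$ set $d(w)\leftarrow u$ for $w\in\mathit{same}(v)$, else $\mathit{same}(p(v))\leftarrow\mathit{same}(p(v))\cup\mathit{same}(v)$) and contract $v$ into $p(v)$; then while an unmarked back or loop arc $(v,u)$ exists: if $v=u$ mark it, else $\mathit{same}(u)\leftarrow\mathit{same}(u)\cup\mathit{same}(v)$ and $\mathit{transform}(u,v)$. All notions refer to the current graph and tree. -}

module Defs where

open import Data.Nat using (ℕ; zero; suc; _<_)
open import Data.Fin as Fin using (Fin; _≟_; toℕ)
open import Data.Bool using (Bool; true; false; if_then_else_)
open import Data.List using (List; []; _∷_; map; _++_)
open import Data.Bool.ListAction using (any)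
open import Data.List.Relation.Unary.Any using (_─_)
open import Data.List.Membership.Propositional using (_∈_; _∉_)
open import Data.List.Relation.Unary.Unique.Propositional using (Unique)
open import Data.Maybe using (Maybe; just; nothing)
open import Data.Product using (Σ; ∃; _×_; _,_)
open import Data.Sum using (_⊎_)
open import Relation.Binary.PropositionalEquality using (_≡_; _≢_)
open import Relation.Nullary using (¬_)
open import Relation.Nullary.Decidable using (⌊_⌋)
open import Relation.Binary.Construct.Closure.ReflexiveTransitive using (Star)

Arc : ℕ → Set
Arc n = Fin n × Fin n

upd : ∀ {n} {B : Set} → (Fin n → B) → Fin n → B → Fin n → B
upd f x b y = if ⌊ y ≟ x ⌋ then b else f y

data Walk {n} (E : List (Arc n)) : Fin n → Fin n → List (Fin n) → Set where
  here : ∀ {x} → Walk E x x (x ∷ [])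
  step : ∀ {x y z vs} → (x , y) ∈ E → Walk E y z vs → Walk E x z (x ∷ vs)

Reachable : ∀ {n} → List (Arc n) → Fin n → Fin n → Set
Reachable E x y = ∃ λ vs → Walk E x y vs

record FlowGraph (n : ℕ) : Set where
  field
    start        : Fin n
    arcs         : List (Arc n)
    nontrivial   : 1 < n
    noMultiArcs  : Unique arcs
    noLoopArcs   : ∀ {x y} → (x , y) ∈ arcs → x ≢ y
    noArcIntoS   : ∀ {x} → (x , start) ∉ arcs
    allReachable : ∀ y → Reachable arcs start y

Dominates : ∀ {n} → List (Arc n) → Fin n → Fin n → Fin n → Set
Dominates E s x y = ∀ vs → Walk E s y vs → x ∈ vs

IsIdom : ∀ {n} → List (Arc n) → Fin n → Fin n → Fin n → Set
IsIdom E s y x =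
  x ≢ y × Dominates E s x y × (∀ z → Dominates E s z y → z ≢ y → Dominates E s z x)

record DFSState (n : ℕ) : Set where
  constructor mkDFS
  field
    visited : Fin n → Bool
    stack   : List (Fin n)
    parent  : Fin n → Maybe (Fin n)

data DFSStep {n} (E : List (Arc n)) : DFSState n → DFSState n → Set where
  descend : ∀ {vis x rest par y} → (x , y) ∈ E → vis y ≡ false →
    DFSStep E (mkDFS vis (x ∷ rest) par)
              (mkDFS (upd vis y true) (y ∷ x ∷ rest) (upd par y (just x)))
  retreat : ∀ {vis x rest par} → (∀ {y} → (x , y) ∈ E → vis y ≡ true) →
    DFSStep E (mkDFS vis (x ∷ rest) par) (mkDFS vis rest par)

dfsInit : ∀ {n} → Fin n → DFSState n
dfsInit s = mkDFS (λ y → ⌊ y ≟ s ⌋) (s ∷ []) (λ _ → nothing)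

-- p is the parent function of a depth-first spanning tree of G
-- (the value p s is irrelevant)
IsDFSTree : ∀ {n} → FlowGraph n → (Fin n → Fin n) → Set
IsDFSTree {n} G p =
  ∃ λ (st : DFSState n) →
    Star (DFSStep (FlowGraph.arcs G)) (dfsInit (FlowGraph.start G)) st ×
    DFSState.stack st ≡ [] ×
    (∀ w → w ≢ FlowGraph.start G → DFSState.parent st w ≡ just (p w))

-- bottom-up numbering (0-based here): a bijection num with num x < num (p x)
IsBottomUpNumbering : ∀ {n} → Fin n → (Fin n → Fin n) → (Fin n → Fin n) → Set
IsBottomUpNumbering s p num =
  (∀ {x y} → num x ≡ num y → x ≡ y) ×
  (∀ x → x ≢ s → toℕ (num x) < toℕ (num (p x)))

data ProperAnc {n} (s : Fin n) (par : Fin n → Fin n) : Fin n → Fin n → Set where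
  parent : ∀ {v} → v ≢ s → ProperAnc s par (par v) v
  up     : ∀ {u v} → v ≢ s → ProperAnc s par u (par v) → ProperAnc s par u v

TreeArc ForwardArc BackArc LoopArc :
  ∀ {n} → Fin n → (Fin n → Fin n) → Fin n → Fin n → Set
TreeArc    s par x w = w ≢ s × x ≡ par w
ForwardArc s par x w = w ≢ s × ProperAnc s par x (par w)
BackArc    s par x w = ProperAnc s par w x
LoopArc    s par x w = x ≡ w

-- State of the modified Algorithm GD. Marked arcs are deleted, so `arcs`
-- is the multiset (list) of current (= unmarked) arcs.

data Phase : Set where
  outArcs inArcs : Phase

record GDState (n : ℕ) : Set where
  constructor mkGD
  field
    alive : Fin n → Bool
    par   : Fin n → Fin n
    arcs  : List (Arc n)
    same  : Fin n → List (Fin n)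
    dom   : Fin n → Maybe (Fin n)
    index : ℕ          -- (0-based) number of the vertex u being processed
    phase : Phase      -- first while loop (outArcs) or second (inArcs)

renameEnd : ∀ {n} → Fin n → Fin n → Fin n → Fin n
renameEnd v pv z = if ⌊ z ≟ v ⌋ then pv else z

contractArcs : ∀ {n} → Fin n → Fin n → List (Arc n) → List (Arc n)
contractArcs v pv = map (λ { (a , b) → (renameEnd v pv a , renameEnd v pv b) })

contractPar : ∀ {n} → (Fin n → Fin n) → Fin n → Fin n → Fin n
contractPar par v z = if ⌊ par z ≟ v ⌋ then par v else par z

setDom : ∀ {n} → (Fin n → Maybe (Fin n)) → List (Fin n) → Fin n → Fin n → Maybe (Fin n)
setDom dom ws x w = if any (λ y → ⌊ w ≟ y ⌋) ws then just x else dom w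

HasArcInto : ∀ {n} → List (Arc n) → Fin n → Set
HasArcInto E v = ∃ λ x → (x , v) ∈ E

module _ {n : ℕ} (s : Fin n) (num : Fin n → Fin n) where

  data GDStep : GDState n → GDState n → Set where
    markOut-keep : ∀ {al par E sm dm k u v} → toℕ (num u) ≡ k →
      (e : (u , v) ∈ E) → TreeArc s par u v ⊎ ForwardArc s par u v →
      HasArcInto (E ─ e) v →
      GDStep (mkGD al par E sm dm k outArcs) (mkGD al par (E ─ e) sm dm k outArcs)
    markOut-tree : ∀ {al par E sm dm k u v} → toℕ (num u) ≡ k →
      (e : (u , v) ∈ E) → TreeArc s par u v ⊎ ForwardArc s par u v →
      ¬ HasArcInto (E ─ e) v → u ≡ par v →
      GDStep (mkGD al par E sm dm k outArcs)
             (mkGD (upd al v false) (contractPar par v)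
                   (contractArcs v (par v) (E ─ e)) sm (setDom dm (sm v) u) k outArcs)
    markOut-fwd : ∀ {al par E sm dm k u v} → toℕ (num u) ≡ k →
      (e : (u , v) ∈ E) → TreeArc s par u v ⊎ ForwardArc s par u v →
      ¬ HasArcInto (E ─ e) v → u ≢ par v →
      GDStep (mkGD al par E sm dm k outArcs)
             (mkGD (upd al v false) (contractPar par v)
                   (contractArcs v (par v) (E ─ e))
                   (upd sm (par v) (sm (par v) ++ sm v)) dm k outArcs)
    outDone : ∀ {al par E sm dm k u} → toℕ (num u) ≡ k →
      (∀ {v} → (u , v) ∈ E → ¬ (TreeArc s par u v ⊎ ForwardArc s par u v)) →
      GDStep (mkGD al par E sm dm k outArcs) (mkGD al par E sm dm k inArcs)
    inLoop : ∀ {al par E sm dm k u} → toℕ (num u) ≡ k →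
      (e : (u , u) ∈ E) →
      GDStep (mkGD al par E sm dm k inArcs) (mkGD al par (E ─ e) sm dm k inArcs)
    -- back arc (v,u), v ≠ u: same(u) ← same(u) ∪ same(v); contract v into p(v)
    -- (replacing transform(u,v))
    inBack : ∀ {al par E sm dm k u v} → toℕ (num u) ≡ k →
      (v , u) ∈ E → BackArc s par v u → v ≢ u →
      GDStep (mkGD al par E sm dm k inArcs)
             (mkGD (upd al v false) (contractPar par v)
                   (contractArcs v (par v) E)
                   (upd sm u (sm u ++ sm v)) dm k inArcs)
    inDone : ∀ {al par E sm dm k u} → toℕ (num u) ≡ k →
      (∀ {v} → (v , u) ∈ E → ¬ (BackArc s par v u ⊎ LoopArc s par v u)) →
      GDStep (mkGD al par E sm dm k inArcs) (mkGD al par E sm dm (suc k) outArcs)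

gdInit : ∀ {n} → FlowGraph n → (Fin n → Fin n) → GDState n
gdInit G p = mkGD (λ _ → true) p (FlowGraph.arcs G) (λ x → x ∷ []) (λ _ → nothing) 0 outArcs

module Submission where

-- Let u be the vertex currently processed and D(x) the subtree of the spanning tree below x.
-- Contraction always goes to the nearest surviving ancestor, so the current vertex of x is its
-- nearest surviving ancestor rep x, and an arc (a , b) is marked only at a time when both ends
-- lie below a processed vertex and rep a is an ancestor of rep b.  The key fact (Bypass) is
-- that, while u is processed, a surviving v ≠ u in D(u) is dominated by no other vertex of D(u)
-- except possibly u, and not even by u once no unmarked arc leads from u into the rest of D(u).
-- It follows by induction along a reverse postorder from an unmarked arc entering D(v) from outside.
-- If v loses its last unmarked in-arc at u, then either u is its parent and the only entry to
-- the merged class, so that u is the immediate dominator of v, or v and its current parent have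
-- the same immediate dominator.  If v is contracted because of a back arc into u, then v is not
-- dominated by u but leads back to u inside D(u), so u and v have the same immediate dominator.
-- Omitting the extra arcs of transform is harmless: an unmarked arc (a , b) left at an already
-- processed rep a comes from a vertex a not dominated by rep a (late-tail).

open import Defs
open import Data.Nat as ℕ using (ℕ; suc; _+_; _∸_; _≤_; _<_; z≤n; s≤s)
open import Data.Nat.Properties as ℕₚ
  using (≤-refl; ≤-trans; <⇒≤; <-irrefl; ≤-<-trans; <-≤-trans; m<n⇒m<1+n; n<1+n; n≤1+n)
open import Data.Nat.Induction using (<-wellFounded)
open import Data.Fin as Fin using (Fin; _≟_; toℕ; fromℕ<)
open import Data.Fin.Properties as Finₚ using (toℕ<n; toℕ-injective; toℕ-fromℕ<)
open import Data.Bool using (Bool; true; false; if_then_else_)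
open import Data.List using (List; []; _∷_; map; _++_; length; allFin)
open import Data.Bool.ListAction using (any)
open import Data.List.Properties using (map-id; length-map; length-removeAt′)
open import Data.List.Relation.Unary.Any as Any using (here; there; _─_; any?)
open import Data.List.Relation.Unary.All as All using ([]; _∷_)
open import Data.List.Relation.Unary.All.Properties using (All¬⇒¬Any)
open import Data.List.Relation.Unary.AllPairs using ([]; _∷_)
open import Data.List.Relation.Unary.Unique.Propositional using (Unique)
open import Data.List.Membership.Propositional using (_∈_; _∉_; find; lose)
open import Data.List.Membership.Propositional.Properties
  using (∈-map⁺; ∈-map⁻; ∈-++⁻; ∈-++⁺ˡ; ∈-++⁺ʳ; ∈-allFin)
import Data.List.Membership.DecPropositional as DecMembership
open import Data.Maybe using (Maybe; just; nothing)
open import Data.Product using (∃; _×_; _,_; proj₁; proj₂)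
open import Data.Sum using (_⊎_; inj₁; inj₂; [_,_]′)
open import Data.Empty using (⊥; ⊥-elim)
open import Function using (_∘_; id)
open import Relation.Nullary using (¬_; Dec; yes; no; contradiction)
open import Relation.Nullary.Decidable using (⌊_⌋; _×-dec_; _⊎-dec_; map′; ¬?)
open import Relation.Binary.PropositionalEquality
  using (_≡_; _≢_; refl; sym; trans; cong; subst; ≢-sym)
open import Relation.Binary.Construct.Closure.ReflexiveTransitive using (Star; ε; _◅_)
open import Induction.WellFounded using (Acc; acc)

-- Function updates and removal from lists.

upd-same : ∀ {n} {B : Set} (f : Fin n → B) x b → upd f x b x ≡ b
upd-same f x b with x ≟ x
... | yes _ = refl
... | no x≢x = contradiction refl x≢x

upd-other : ∀ {n} {B : Set} (f : Fin n → B) {x y} b → y ≢ x → upd f x b y ≡ f y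
upd-other f {x} {y} b y≢x with y ≟ x
... | yes y≡x = contradiction y≡x y≢x
... | no _ = refl

upd-true : ∀ {n} (f : Fin n → Bool) x {y} → f y ≡ true → upd f x true y ≡ true
upd-true f x {y} fy with y ≟ x
... | yes _ = refl
... | no _ = fy

injective⇒surjective : ∀ {n} (f : Fin n → Fin n) → (∀ {x y} → f x ≡ f y → x ≡ y) →
  ∀ y → ∃ λ x → f x ≡ y
injective⇒surjective {suc n} f inj y with Finₚ.any? (λ x → f x ≟ y)
... | yes found = found
... | no missed = contradiction (Finₚ.injective⇒≤ punched-injective) (ℕₚ.<⇒≱ (n<1+n n))
  where
  y≢f : ∀ x → y ≢ f x
  y≢f x y≡fx = missed (x , sym y≡fx)
  punched : Fin (suc n) → Fin n
  punched x = Fin.punchOut (y≢f x)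
  punched-injective : ∀ {x z} → punched x ≡ punched z → x ≡ z
  punched-injective eq = inj (Finₚ.punchOut-injective (y≢f _) (y≢f _) eq)

─-⊆ : ∀ {A : Set} {x y : A} {xs} (e : y ∈ xs) → x ∈ (xs ─ e) → x ∈ xs
─-⊆ (here _) x∈ = there x∈
─-⊆ (there e) (here eq) = here eq
─-⊆ (there e) (there x∈) = there (─-⊆ e x∈)

∈-─ : ∀ {A : Set} {x y : A} {xs} (e : y ∈ xs) → x ∈ xs → x ∈ (xs ─ e) ⊎ x ≡ y
∈-─ (here y≡z) (here x≡z) = inj₂ (trans x≡z (sym y≡z))
∈-─ (here _) (there x∈) = inj₁ x∈
∈-─ (there _) (here x≡z) = inj₁ (here x≡z)
∈-─ (there e) (there x∈) with ∈-─ e x∈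
... | inj₁ x∈′ = inj₁ (there x∈′)
... | inj₂ x≡y = inj₂ x≡y

─-< : ∀ {A : Set} {y : A} {xs} (e : y ∈ xs) → length (xs ─ e) < length xs
─-< {xs = xs} e = ℕₚ.≤-reflexive (sym (length-removeAt′ xs (Any.index e)))

-- Lifts the deletion of a marked arc of the current multigraph to the deletion of the arc of `G`
-- whose image it is.
map-─ : ∀ {A B : Set} (f : A → B) {y} xs (e : y ∈ map f xs) →
  ∃ λ x → ∃ λ (e′ : x ∈ xs) → f x ≡ y × (map f xs ─ e) ≡ map f (xs ─ e′)
map-─ f (x ∷ xs) (here y≡fx) = x , here refl , sym y≡fx , refl
map-─ f (x ∷ xs) (there e) with map-─ f xs e
... | x′ , e′ , eq , eqs = x′ , there e′ , eq , cong (f x ∷_) eqs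

-- Ancestors in a tree of parent pointers.

-- The reflexive form of `ProperAnc`; it never reads the irrelevant value `q s`.
data Anc {n} (s : Fin n) (q : Fin n → Fin n) (u : Fin n) : Fin n → Set where
  self : Anc s q u u
  up   : ∀ {v} → v ≢ s → Anc s q u (q v) → Anc s q u v

module _ {n} {s : Fin n} {q : Fin n → Fin n} where

  anc-trans : ∀ {x y z} → Anc s q x y → Anc s q y z → Anc s q x z
  anc-trans xy self = xy
  anc-trans xy (up z≢s yz) = up z≢s (anc-trans xy yz)

  anc-start : ∀ {x} → Anc s q x s → x ≡ s
  anc-start self = refl
  anc-start (up s≢s _) = contradiction refl s≢s

  anc-parent : ∀ {x y} → Anc s q x y → x ≢ y → Anc s q x (q y)
  anc-parent self x≢x = contradiction refl x≢x
  anc-parent (up _ xqy) _ = xqy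

  anc-≢start : ∀ {x y} → Anc s q x y → x ≢ y → y ≢ s
  anc-≢start self x≢x = contradiction refl x≢x
  anc-≢start (up y≢s _) _ = y≢s

  anc-comparable : ∀ {x y z} → Anc s q x z → Anc s q y z → Anc s q x y ⊎ Anc s q y x
  anc-comparable self yz = inj₂ yz
  anc-comparable (up z≢s xqz) self = inj₁ (up z≢s xqz)
  anc-comparable (up _ xqz) (up _ yqz) = anc-comparable xqz yqz

  properAnc⇒anc : ∀ {u v} → ProperAnc s q u v → v ≢ s × Anc s q u (q v)
  properAnc⇒anc (parent v≢s) = v≢s , self
  properAnc⇒anc (up v≢s uqv) with properAnc⇒anc uqv
  ... | qv≢s , uqqv = v≢s , up qv≢s uqqv

  anc⇒properAnc : ∀ {u v} → v ≢ s → Anc s q u (q v) → ProperAnc s q u v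
  anc⇒properAnc v≢s self = parent v≢s
  anc⇒properAnc v≢s (up qv≢s uqqv) = up v≢s (anc⇒properAnc qv≢s uqqv)

  module _ (num : Fin n → Fin n) (num-up : ∀ x → x ≢ s → toℕ (num x) < toℕ (num (q x))) where

    anc-num : ∀ {x y} → Anc s q x y → toℕ (num y) ≤ toℕ (num x)
    anc-num self = ≤-refl
    anc-num (up {v} v≢s xqv) = <⇒≤ (<-≤-trans (num-up v v≢s) (anc-num xqv))

    anc-num-< : ∀ {x y} → Anc s q x y → x ≢ y → toℕ (num y) < toℕ (num x)
    anc-num-< self x≢x = contradiction refl x≢x
    anc-num-< (up {v} v≢s xqv) _ = <-≤-trans (num-up v v≢s) (anc-num xqv)

    anc-antisym : ∀ {x y} → Anc s q x y → Anc s q y x → x ≡ y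
    anc-antisym {x} {y} xy yx with x ≟ y
    ... | yes x≡y = x≡y
    ... | no x≢y = contradiction (<-≤-trans (anc-num-< xy x≢y) (anc-num yx)) (<-irrefl refl)

    private
      -- A step to the parent raises the number, which stays below `n`; this makes recursion up the
      -- tree well-founded.
      climb : ∀ {y} → y ≢ s → n ∸ toℕ (num (q y)) < n ∸ toℕ (num y)
      climb {y} y≢s = ℕₚ.∸-monoʳ-< (num-up y y≢s) (<⇒≤ (toℕ<n (num (q y))))

      anc?-acc : ∀ x y → Acc _<_ (n ∸ toℕ (num y)) → Dec (Anc s q x y)
      anc?-acc x y (acc rs) with x ≟ y | y ≟ s
      ... | yes refl | _ = yes self
      ... | no x≢y | yes refl = no (λ xs → x≢y (anc-start xs))
      ... | no x≢y | no y≢s =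
        map′ (up y≢s) (λ xy → anc-parent xy x≢y) (anc?-acc x (q y) (rs (climb y≢s)))

      start-anc-acc : ∀ y → Acc _<_ (n ∸ toℕ (num y)) → Anc s q s y
      start-anc-acc y (acc rs) with y ≟ s
      ... | yes refl = self
      ... | no y≢s = up y≢s (start-anc-acc (q y) (rs (climb y≢s)))

    anc? : ∀ x y → Dec (Anc s q x y)
    anc? x y = anc?-acc x y (<-wellFounded _)

    start-anc : ∀ y → Anc s q s y
    start-anc y = start-anc-acc y (<-wellFounded _)

-- Dominance through paths that avoid a vertex.

module Avoidance {n} (G : FlowGraph n) where
  open FlowGraph G renaming (start to s; arcs to A)
  open DecMembership (_≟_ {n}) using (_∈?_)

  -- The negation of `Av z y` is dominance of `y` by `z`. The path grows at its last arc, which is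
  -- where the later inductions take it apart.
  data Av (z : Fin n) : Fin n → Set where
    root : s ≢ z → Av z s
    ext  : ∀ {a b} → Av z a → (a , b) ∈ A → b ≢ z → Av z b

  av-≢ : ∀ {z y} → Av z y → y ≢ z
  av-≢ (root s≢z) = s≢z
  av-≢ (ext _ _ b≢z) = b≢z

  private
    walk-head : ∀ {x y vs} → Walk A x y vs → x ∈ vs
    walk-head here = here refl
    walk-head (step _ _) = here refl

    walk-snoc : ∀ {x y z vs} → Walk A x y vs → (y , z) ∈ A → Walk A x z (vs ++ z ∷ [])
    walk-snoc here yz = step yz here
    walk-snoc (step xy w) yz = step xy (walk-snoc w yz)

    av-along : ∀ {z x y vs} → Walk A x y vs → z ∉ vs → Av z x → Av z y
    av-along here _ av = av
    av-along (step xy w) z∉ av =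
      av-along w (z∉ ∘ there) (ext av xy (λ { refl → z∉ (there (walk-head w)) }))

    av⇒walk : ∀ {z y} → Av z y → ∃ λ vs → Walk A s y vs × z ∉ vs
    av⇒walk (root s≢z) = s ∷ [] , here , λ { (here refl) → s≢z refl }
    av⇒walk {z} (ext {b = b} av ab b≢z) with av⇒walk av
    ... | vs , w , z∉ = vs ++ b ∷ [] , walk-snoc w ab , z∉′
      where
      z∉′ : z ∉ vs ++ b ∷ []
      z∉′ z∈ with ∈-++⁻ vs z∈
      ... | inj₁ z∈vs = z∉ z∈vs
      ... | inj₂ (here refl) = b≢z refl

    dominates⇒¬av : ∀ {z y} → Dominates A s z y → ¬ Av z y
    dominates⇒¬av dom av with av⇒walk av
    ... | vs , w , z∉ = z∉ (dom vs w)

    -- It is decidable whether a given walk meets `z`, and one that does not is itself a witness of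
    -- `Av z y`.
    ¬av⇒dominates : ∀ {z y} → ¬ Av z y → Dominates A s z y
    ¬av⇒dominates {z} ¬av vs w with z ∈? vs
    ... | yes z∈ = z∈
    ... | no z∉ = contradiction (av-along w z∉ (root (λ { refl → z∉ (walk-head w) }))) ¬av

  -- Positive form of IsIdom, with "z does not dominate" replaced by a path avoiding z.
  record Idom (x y : Fin n) : Set where
    constructor mkIdom
    field
      proper    : x ≢ y
      dominates : ¬ Av x y
      closest   : ∀ {z} → z ≢ y → Av z x → Av z y

  idom⇒IsIdom : ∀ {x y} → Idom x y → IsIdom A s y x
  idom⇒IsIdom (mkIdom x≢y ¬av closest) =
    x≢y , ¬av⇒dominates ¬av ,
    λ z zdom z≢y → ¬av⇒dominates (λ av → dominates⇒¬av zdom (closest z≢y av))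

  module _ {p : Fin n → Fin n} (tree-arc : ∀ {w} → w ≢ s → (p w , w) ∈ A) where

    -- The extension by tree arcs could meet `z` only on the tree path from `x` to `y`, which the
    -- last hypothesis rules out.
    av-down : ∀ {z x y} → Av z x → Anc s p x y → (Anc s p x z → Anc s p z y → ⊥) → Av z y
    av-down av self _ = av
    av-down av (up v≢s xpv) off =
      ext (av-down av xpv (λ xz zpv → off xz (up v≢s zpv))) (tree-arc v≢s)
          (λ { refl → off (up v≢s xpv) self })

-- Depth-first search and finishing times.

module DepthFirst {n} (G : FlowGraph n) (p : Fin n → Fin n) where
  open FlowGraph G renaming (start to s; arcs to A)
  open DFSState

  _⊴_ : Fin n → Fin n → Set
  _⊴_ = Anc s p

  -- The search stack is the path from its top up to `s` in the final tree `p`.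
  data Chain : List (Fin n) → Set where
    empty : Chain []
    bot   : Chain (s ∷ [])
    push  : ∀ {x xs} → x ≢ s → Chain (p x ∷ xs) → Chain (x ∷ p x ∷ xs)

  chain-tail : ∀ {x xs} → Chain (x ∷ xs) → Chain xs
  chain-tail bot = empty
  chain-tail (push _ c) = c

  chain-parent : ∀ {xs w} → Chain xs → w ∈ xs → w ≢ s → p w ∈ xs
  chain-parent bot (here refl) w≢s = contradiction refl w≢s
  chain-parent (push _ c) (here refl) _ = there (here refl)
  chain-parent (push _ c) (there w∈) w≢s = there (chain-parent c w∈ w≢s)

  chain-anc : ∀ {x xs v} → Chain (x ∷ xs) → v ∈ x ∷ xs → v ⊴ x
  chain-anc _ (here refl) = self
  chain-anc (push x≢s c) (there v∈) = up x≢s (chain-anc c v∈)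

  record Done (st : DFSState n) (a : Fin n) : Set where
    constructor done
    field
      visited-done : visited st a ≡ true
      off-stack    : a ∉ stack st

  -- Ancestry is always taken in the final tree `p`, with which the recorded parents agree on
  -- visited vertices. `fin` holds finishing times and `clock` the next one to be given.
  -- `enter-open` prepares `enter-done` for the moment when `v` leaves the stack.
  record DFSInv (st : DFSState n) (fin : Fin n → ℕ) (clock : ℕ) : Set where
    field
      root-visited  : visited st s ≡ true
      stack-visited : ∀ {v} → v ∈ stack st → visited st v ≡ true
      stack-unique  : Unique (stack st)
      stack-chain   : Chain (stack st)
      parent-visited : ∀ {w} → visited st w ≡ true → w ≢ s → visited st (p w) ≡ true
      parent-arc    : ∀ {w} → visited st w ≡ true → w ≢ s → (p w , w) ∈ A
      record-visited : ∀ {w y} → DFSState.parent st w ≡ just y → visited st w ≡ true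
      visited-record : ∀ {w} → visited st w ≡ true → w ≢ s → DFSState.parent st w ≡ just (p w)
      done-arcs     : ∀ {a b} → Done st a → (a , b) ∈ A → visited st b ≡ true
      done-child    : ∀ {w} → visited st w ≡ true → w ≢ s → Done st (p w) →
                      Done st w × fin w < fin (p w)
      enter-open    : ∀ {a b v} → Done st a → v ∈ stack st → (a , b) ∈ A → v ⊴ b → v ⊴ a
      enter-done    : ∀ {a b v} → Done st a → Done st v → (a , b) ∈ A → v ⊴ b → ¬ v ⊴ a →
                      fin v < fin a
      fin-bound     : ∀ {a} → Done st a → fin a < clock

  open DFSInv

  visited-anc : ∀ {st fin c v b} → DFSInv st fin c → visited st b ≡ true → v ⊴ b →
    visited st v ≡ true
  visited-anc inv vis self = vis
  visited-anc inv vis (up b≢s vpb) = visited-anc inv (parent-visited inv vis b≢s) vpb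

  -- A parent is recorded only on the descent to an unvisited vertex, so it is never overwritten.
  -- This is how `final-inv` knows, at the descent to `y`, that the final `p y` is the current top
  -- `x`.
  parent-persists : ∀ {st st′ w y} → Star (DFSStep A) st st′ →
    (∀ {w y} → DFSState.parent st w ≡ just y → visited st w ≡ true) →
    DFSState.parent st w ≡ just y → DFSState.parent st′ w ≡ just y
  parent-persists ε _ eq = eq
  parent-persists {w = w} (descend {vis} {x} {rest} {par} {z} xz unvis ◅ steps) recorded eq =
    parent-persists steps recorded′ (trans (upd-other par (just x) w≢z) eq)
    where
    w≢z : w ≢ z
    w≢z refl = contradiction (trans (sym unvis) (recorded eq)) (λ ())
    recorded′ : ∀ {w y} → upd par z (just x) w ≡ just y → upd vis z true w ≡ true
    recorded′ {w} eq with w ≟ z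
    ... | yes _ = refl
    ... | no _ = recorded eq
  parent-persists (retreat _ ◅ steps) recorded eq = parent-persists steps recorded eq

  init-inv : DFSInv (dfsInit s) (λ _ → 0) 0
  init-inv = λ where
      .root-visited → root-is-visited
      .stack-visited (here refl) → root-is-visited
      .stack-unique → [] ∷ []
      .stack-chain → bot
      .parent-visited vis w≢s → contradiction (only-root vis) w≢s
      .parent-arc vis w≢s → contradiction (only-root vis) w≢s
      .record-visited ()
      .visited-record vis w≢s → contradiction (only-root vis) w≢s
      .done-arcs d → ⊥-elim (none-done d)
      .done-child _ _ d → ⊥-elim (none-done d)
      .enter-open d → ⊥-elim (none-done d)
      .enter-done d → ⊥-elim (none-done d)
      .fin-bound d → ⊥-elim (none-done d)
    where
    root-is-visited : ⌊ s ≟ s ⌋ ≡ true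
    root-is-visited with s ≟ s
    ... | yes _ = refl
    ... | no s≢s = contradiction refl s≢s
    only-root : ∀ {w} → ⌊ w ≟ s ⌋ ≡ true → w ≡ s
    only-root {w} vis with w ≟ s
    ... | yes w≡s = w≡s
    ... | no _ = contradiction vis (λ ())
    none-done : ∀ {a} → ¬ Done (dfsInit s) a
    none-done (done vis off) with only-root vis
    ... | refl = off (here refl)

  descend-inv : ∀ {vis x rest par y fin c} → DFSInv (mkDFS vis (x ∷ rest) par) fin c →
    (x , y) ∈ A → vis y ≡ false → p y ≡ x →
    DFSInv (mkDFS (upd vis y true) (y ∷ x ∷ rest) (upd par y (just x))) fin c
  descend-inv {vis} {x} {rest} {par} {y} {fin} {c} inv xy unvis refl = λ where
      .root-visited → grow (root-visited inv)
      .stack-visited (here refl) → upd-same vis y true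
      .stack-visited (there v∈) → grow (stack-visited inv v∈)
      .stack-unique → All.tabulate (λ { v∈ refl → fresh (stack-visited inv v∈) }) ∷ stack-unique inv
      .stack-chain → push (λ { refl → fresh (root-visited inv) }) (stack-chain inv)
      .parent-visited → pv
      .parent-arc → pa
      .record-visited → rv
      .visited-record → vr
      .done-arcs d ab → grow (done-arcs inv (old d) ab)
      .done-child → dc
      -- The head `b` of an arc from a finished vertex was visited earlier, and so were its
      -- ancestors, whereas `y` was not.
      .enter-open d (here refl) ab yb →
        ⊥-elim (fresh (visited-anc inv (done-arcs inv (old d) ab) yb))
      .enter-open d (there v∈) ab vb → enter-open inv (old d) v∈ ab vb
      .enter-done da dv → enter-done inv (old da) (old dv)
      .fin-bound d → fin-bound inv (old d)
    where
    st′ : DFSState n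
    st′ = mkDFS (upd vis y true) (y ∷ p y ∷ rest) (upd par y (just (p y)))
    grow : ∀ {v} → vis v ≡ true → upd vis y true v ≡ true
    grow = upd-true vis y
    fresh : vis y ≢ true
    fresh visy = contradiction (trans (sym unvis) visy) (λ ())
    shrink : ∀ {v} → v ≢ y → upd vis y true v ≡ true → vis v ≡ true
    shrink v≢y vis′ = trans (sym (upd-other vis true v≢y)) vis′
    old : ∀ {a} → Done st′ a → Done (mkDFS vis (p y ∷ rest) par) a
    old (done vis′ off) = done (shrink (λ { refl → off (here refl) }) vis′) (off ∘ there)
    pv : ∀ {w} → upd vis y true w ≡ true → w ≢ s → upd vis y true (p w) ≡ true
    pv {w} vis′ w≢s with w ≟ y
    ... | yes refl = grow (stack-visited inv (here refl))
    ... | no _ = grow (parent-visited inv vis′ w≢s)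
    pa : ∀ {w} → upd vis y true w ≡ true → w ≢ s → (p w , w) ∈ A
    pa {w} vis′ w≢s with w ≟ y
    ... | yes refl = xy
    ... | no _ = parent-arc inv vis′ w≢s
    rv : ∀ {w z} → upd par y (just (p y)) w ≡ just z → upd vis y true w ≡ true
    rv {w} eq with w ≟ y
    ... | yes _ = refl
    ... | no _ = record-visited inv eq
    vr : ∀ {w} → upd vis y true w ≡ true → w ≢ s → upd par y (just (p y)) w ≡ just (p w)
    vr {w} vis′ w≢s with w ≟ y
    ... | yes refl = refl
    ... | no _ = visited-record inv vis′ w≢s
    dc : ∀ {w} → upd vis y true w ≡ true → w ≢ s → Done st′ (p w) → Done st′ w × fin w < fin (p w)
    dc {w} vis′ w≢s d with w ≟ y
    ... | yes refl = contradiction (there (here refl)) (Done.off-stack d)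
    ... | no w≢y with done-child inv vis′ w≢s (old d)
    ...   | done visw off , lt = done (grow visw) (λ { (here eq) → w≢y eq ; (there w∈) → off w∈ }) , lt

  retreat-inv : ∀ {vis x rest par fin c} → DFSInv (mkDFS vis (x ∷ rest) par) fin c →
    (∀ {y} → (x , y) ∈ A → vis y ≡ true) →
    DFSInv (mkDFS vis rest par) (upd fin x c) (suc c)
  retreat-inv {vis} {x} {rest} {par} {fin} {c} inv exhausted = λ where
      .root-visited → root-visited inv
      .stack-visited v∈ → stack-visited inv (there v∈)
      .stack-unique → unique-tail (stack-unique inv)
      .stack-chain → chain-tail (stack-chain inv)
      .parent-visited → parent-visited inv
      .parent-arc → parent-arc inv
      .record-visited → record-visited inv
      .visited-record → visited-record inv
      .done-arcs → da
      .done-child → dc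
      .enter-open → eo
      .enter-done → ed
      .fin-bound → fb
    where
    st st′ : DFSState n
    st = mkDFS vis (x ∷ rest) par
    st′ = mkDFS vis rest par
    unique-tail : ∀ {y ys} → Unique (y ∷ ys) → Unique ys
    unique-tail (_ ∷ u) = u
    x∉rest : x ∉ rest
    x∉rest with stack-unique inv
    ... | x≢ ∷ _ = All¬⇒¬Any x≢
    old : ∀ {a} → a ≢ x → Done st′ a → Done st a
    old a≢x (done v off) = done v (λ { (here eq) → a≢x eq ; (there a∈) → off a∈ })
    new : ∀ {a} → Done st a → Done st′ a
    new (done v off) = done v (off ∘ there)
    da : ∀ {a b} → Done st′ a → (a , b) ∈ A → vis b ≡ true
    da {a} d ab with a ≟ x
    ... | yes refl = exhausted ab
    ... | no a≢x = done-arcs inv (old a≢x d) ab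
    eo : ∀ {a b v} → Done st′ a → v ∈ rest → (a , b) ∈ A → v ⊴ b → v ⊴ a
    eo {a} d v∈ ab vb with a ≟ x
    -- Everything left on the stack is an ancestor of the finishing vertex `x`.
    ... | yes refl = chain-anc (stack-chain inv) (there v∈)
    ... | no a≢x = enter-open inv (old a≢x d) (there v∈) ab vb
    ed : ∀ {a b v} → Done st′ a → Done st′ v → (a , b) ∈ A → v ⊴ b → ¬ v ⊴ a →
      upd fin x c v < upd fin x c a
    ed {a} {b} {v} d dv ab vb ¬va with a ≟ x | v ≟ x
    ... | yes refl | yes refl = contradiction self ¬va
    ... | yes refl | no v≢x = fin-bound inv (old v≢x dv)
    -- `a` finished while `x` was on the stack, so by `enter-open` it lies below `x` and the arc
    -- does not enter from outside.
    ... | no a≢x | yes refl = contradiction (enter-open inv (old a≢x d) (here refl) ab vb) ¬va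
    ... | no a≢x | no v≢x = enter-done inv (old a≢x d) (old v≢x dv) ab vb ¬va
    fb : ∀ {a} → Done st′ a → upd fin x c a < suc c
    fb {a} d with a ≟ x
    ... | yes refl = ≤-refl
    ... | no a≢x = m<n⇒m<1+n (fin-bound inv (old a≢x d))
    dc : ∀ {w} → vis w ≡ true → w ≢ s → Done st′ (p w) →
      Done st′ w × upd fin x c w < upd fin x c (p w)
    dc {w} vw w≢s d with w ≟ x | p w ≟ x
    ... | yes refl | yes pw≡w =
      contradiction (sym pw≡w) (noLoopArcs (parent-arc inv vw w≢s) ∘ sym)
    ... | yes refl | no pw≢x with done-child inv vw w≢s (old pw≢x d)
    ...   | done _ off , _ = contradiction (here refl) off
    dc {w} vw w≢s d | no w≢x | yes refl = new dw , fin-bound inv dw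
      where
      -- If the child `w` were in `rest`, so would be its parent `x`, which is already the top of a
      -- duplicate-free stack.
      dw : Done st w
      dw = done vw (λ { (here eq) → w≢x eq
                      ; (there w∈) → x∉rest (chain-parent (chain-tail (stack-chain inv)) w∈ w≢s) })
    dc {w} vw w≢s d | no w≢x | no pw≢x with done-child inv vw w≢s (old pw≢x d)
    ... | dw , lt = new dw , lt

  final-inv : ∀ {st st′ fin c} → DFSInv st fin c → Star (DFSStep A) st st′ →
    (∀ w → w ≢ s → DFSState.parent st′ w ≡ just (p w)) →
    ∃ λ fin′ → ∃ λ c′ → DFSInv st′ fin′ c′
  final-inv inv ε _ = _ , _ , inv
  final-inv {st′ = st′} inv (descend {vis} {x} {rest} {par} {y} xy unvis ◅ steps) result =
    final-inv inv′ steps result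
    where
    inv′ : DFSInv (mkDFS (upd vis y true) (y ∷ x ∷ rest) (upd par y (just x))) _ _
    inv′ = descend-inv inv xy unvis (parent-is-x (trans (sym (result y y≢s)) recorded))
      where
      y≢s : y ≢ s
      y≢s refl = contradiction (trans (sym unvis) (root-visited inv)) (λ ())
      parent-is-x : ∀ {a b : Fin n} → just a ≡ just b → a ≡ b
      parent-is-x refl = refl
      recorded′ : ∀ {w z} → upd par y (just x) w ≡ just z → upd vis y true w ≡ true
      recorded′ {w} eq with w ≟ y
      ... | yes _ = refl
      ... | no _ = record-visited inv eq
      recorded : DFSState.parent st′ y ≡ just x
      recorded = parent-persists steps recorded′ (upd-same par y (just x))
  final-inv inv (retreat exhausted ◅ steps) result =
    final-inv (retreat-inv inv exhausted) steps result

  -- rank is a reverse postorder: arcs entering a subtree come from vertices finishing later.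
  record Ranking : Set where
    field
      rank       : Fin n → ℕ
      rank-enter : ∀ {a b x v} → (a , b) ∈ A → x ⊴ a → v ⊴ b → ¬ v ⊴ a → rank x < rank v
      tree-arc   : ∀ {w} → w ≢ s → (p w , w) ∈ A

  -- No vertex finishes before its descendants (`fin-anc`), so the inequality for the tail `a`
  -- passes to every ancestor `x` of `a`. Subtraction from the clock reverses the order of
  -- finishing.
  ranking : IsDFSTree G p → Ranking
  ranking (st , steps , refl , result) with final-inv init-inv steps result
  ... | fin , c , inv = λ where
      .Ranking.rank x → c ∸ fin x
      .Ranking.rank-enter {a} {b} {x} {v} ab xa vb ¬va →
        ℕₚ.∸-monoʳ-< (<-≤-trans (enter-done inv (finished a) (finished v) ab vb ¬va) (fin-anc xa))
                     (<⇒≤ (fin-bound inv (finished x)))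
      .Ranking.tree-arc {w} w≢s → parent-arc inv (Done.visited-done (finished w)) w≢s
    where
    finished : ∀ a → Done st a
    finished a = done visited-all (λ ())
      where
      visited-all : visited st a ≡ true
      visited-all with a ≟ s
      ... | yes refl = root-visited inv
      ... | no a≢s = record-visited inv (result a a≢s)
    fin-anc : ∀ {x a} → x ⊴ a → fin a ≤ fin x
    fin-anc self = ≤-refl
    fin-anc (up {v} v≢s xpv) =
      ≤-trans (<⇒≤ (proj₂ (done-child inv (Done.visited-done (finished v)) v≢s (finished (p v)))))
              (fin-anc xpv)

-- The contracted graph and its representatives.

module Contraction {n} (G : FlowGraph n) (p num : Fin n → Fin n)
  (numbering : IsBottomUpNumbering (FlowGraph.start G) p num)
  (ranking : DepthFirst.Ranking G p) where

  open FlowGraph G renaming (start to s; arcs to A)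
  open Avoidance G
  open DepthFirst G p using (_⊴_)
  open DepthFirst.Ranking ranking

  N : Fin n → ℕ
  N x = toℕ (num x)

  N-injective : ∀ {x y} → N x ≡ N y → x ≡ y
  N-injective eq = proj₁ numbering (toℕ-injective eq)

  num-up : ∀ x → x ≢ s → N x < N (p x)
  num-up = proj₂ numbering

  ⊴-antisym : ∀ {x y} → x ⊴ y → y ⊴ x → x ≡ y
  ⊴-antisym = anc-antisym num num-up

  ⊴-N : ∀ {x y} → x ⊴ y → N y ≤ N x
  ⊴-N = anc-num num num-up

  ⊴-N-< : ∀ {x y} → x ⊴ y → x ≢ y → N y < N x
  ⊴-N-< = anc-num-< num num-up

  ≢-between : ∀ {x y z} → x ⊴ y → y ⊴ z → x ≢ y → x ≢ z
  ≢-between xy yz x≢y refl = x≢y (⊴-antisym xy yz)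

  ⊴-of-lower : ∀ {u u′ x} → u ⊴ x → u′ ⊴ x → N u′ ≤ N u → u ⊴ u′
  ⊴-of-lower ux u′x le with anc-comparable ux u′x
  ... | inj₁ uu′ = uu′
  ... | inj₂ u′u with N-injective (ℕₚ.≤-antisym (⊴-N u′u) le)
  ...   | refl = self

  down : ∀ {z x y} → Av z x → x ⊴ y → (x ⊴ z → z ⊴ y → ⊥) → Av z y
  down = av-down tree-arc

  -- The tree path from `s` to `y` misses every vertex that is not an ancestor of `y`. Hence
  -- dominators are ancestors, and `av-dec` may assume `z ⊴ y`.
  av-outside : ∀ {z y} → ¬ z ⊴ y → Av z y
  av-outside {z} {y} ¬zy =
    down (root (λ { refl → ¬zy (start-anc num num-up y) })) (start-anc num num-up y) (λ _ → ¬zy)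

  av-dec : ∀ {z y} → (z ⊴ y → Av z y) → Av z y
  av-dec {z} {y} f with anc? num num-up z y
  ... | yes zy = f zy
  ... | no ¬zy = av-outside ¬zy

  ¬av-start : ∀ {y} → ¬ Av s y
  ¬av-start (root s≢s) = s≢s refl
  ¬av-start (ext av _ _) = ¬av-start av

  both : (Fin n → Fin n) → Arc n → Arc n
  both f (a , b) = f a , f b

  -- All that is remembered of a marked arc. Contraction preserves it: representatives are nearest
  -- surviving ancestors, so their order along a tree path is kept.
  Closed : ℕ → (Fin n → Fin n) → Fin n → Fin n → Set
  Closed k rep a b = (∃ λ u → N u ≤ k × u ⊴ a × u ⊴ b) × rep a ⊴ rep b

  -- rep x is the vertex into which x has been contracted so far, F the list of arcs of G whose
  -- images are still unmarked.  Indices below `bound` have completed their outArcs phase.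
  record Base (al : Fin n → Bool) (par : Fin n → Fin n) (E : List (Arc n)) (k bound : ℕ)
              (rep : Fin n → Fin n) (F : List (Arc n)) : Set where
    field
      rep-alive : ∀ x → al (rep x) ≡ true
      rep-fix   : ∀ {x} → al x ≡ true → rep x ≡ x
      rep-anc   : ∀ x → rep x ⊴ x
      rep-low   : ∀ {x y} → al y ≡ true → y ⊴ x → y ⊴ rep x
      par-rep   : ∀ x → par x ≡ rep (p x)
      arcs-map  : E ≡ map (both rep) F
      F⊆A       : ∀ {a b} → (a , b) ∈ F → (a , b) ∈ A
      closed    : ∀ {a b} → (a , b) ∈ A → (a , b) ∈ F ⊎ Closed k rep a b
      moved-low : ∀ x → rep x ≢ x → N (rep x) ≤ k
      dead-av   : ∀ {z v} → al z ≡ false → al v ≡ true → z ⊴ v → Av z v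
      late-tail : ∀ {a b} → (a , b) ∈ F → N (rep a) < bound → rep a ⊴ b → rep a ≢ rep b →
                  Av (rep a) a

  module BaseProperties {al par E k bound rep F} (B : Base al par E k bound rep F) where
    open Base B public

    rep-of : ∀ {x v} → al v ≡ true → v ⊴ x → (∀ {y} → al y ≡ true → y ⊴ x → y ⊴ v) → rep x ≡ v
    rep-of {x} alv vx nearest = ⊴-antisym (nearest (rep-alive x) (rep-anc x)) (rep-low alv vx)

    start-alive : al s ≡ true
    start-alive = subst (λ x → al x ≡ true) (anc-start (rep-anc s)) (rep-alive s)

    dead : ∀ {x} → al x ≡ false → rep x ≢ x
    dead {x} alx eq = contradiction (trans (sym alx) (subst (λ y → al y ≡ true) eq (rep-alive x))) (λ ())

    -- A dead `u` would be represented by a proper ancestor, whose number exceeds `k`, against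
    -- `moved-low`.
    current-alive : ∀ {u} → N u ≡ k → al u ≡ true
    current-alive {u} Nu≡k with al u in alu
    ... | true = refl
    ... | false = contradiction
      (<-≤-trans (⊴-N-< (rep-anc u) (dead alu)) (subst (_ ≤_) (sym Nu≡k) (moved-low u (dead alu))))
      (<-irrefl refl)

    arc-image : ∀ {a b} → (a , b) ∈ F → (rep a , rep b) ∈ E
    arc-image ab rewrite arcs-map = ∈-map⁺ (both rep) ab

    arc-preimage : ∀ {x y} → (x , y) ∈ E → ∃ λ a → ∃ λ b → (a , b) ∈ F × rep a ≡ x × rep b ≡ y
    arc-preimage xy rewrite arcs-map with ∈-map⁻ (both rep) xy
    ... | (a , b) , ab , refl = a , b , ab , refl , refl

    tail-alive : ∀ {x y} → (x , y) ∈ E → al x ≡ true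
    tail-alive xy with arc-preimage xy
    ... | a , _ , _ , refl , _ = rep-alive a

    head-alive : ∀ {x y} → (x , y) ∈ E → al y ≡ true
    head-alive xy with arc-preimage xy
    ... | _ , b , _ , _ , refl = rep-alive b

    par-alive : ∀ v → al (par v) ≡ true
    par-alive v rewrite par-rep v = rep-alive (p v)

    par-anc : ∀ {v} → v ≢ s → par v ⊴ v
    par-anc {v} v≢s rewrite par-rep v = up v≢s (rep-anc (p v))

    par-up : ∀ v → v ≢ s → N v < N (par v)
    par-up v v≢s rewrite par-rep v = <-≤-trans (num-up v v≢s) (⊴-N (rep-anc (p v)))

    par-≢ : ∀ {v} → v ≢ s → par v ≢ v
    par-≢ {v} v≢s eq = <-irrefl (cong N (sym eq)) (par-up v v≢s)

    par-low : ∀ {y v} → al y ≡ true → y ⊴ v → y ≢ v → y ⊴ par v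
    par-low {y} {v} aly yv y≢v rewrite par-rep v = rep-low aly (anc-parent yv y≢v)

    par-anc⇒⊴ : ∀ {u v} → Anc s par u v → u ⊴ v
    par-anc⇒⊴ self = self
    par-anc⇒⊴ (up v≢s uv) = anc-trans (par-anc⇒⊴ uv) (par-anc v≢s)

    -- The current tree is the original one restricted to the survivors: on the way up from `x`, a
    -- dead vertex can be skipped because it shares its representative with its parent.
    ⊴⇒par-anc-rep : ∀ {u x} → al u ≡ true → u ⊴ x → Anc s par u (rep x)
    ⊴⇒par-anc-rep alu self rewrite rep-fix alu = self
    ⊴⇒par-anc-rep {u} alu (up {x} x≢s upx) with al x in alx
    ... | true rewrite rep-fix alx =
      up x≢s (subst (Anc s par u) (sym (par-rep x)) (⊴⇒par-anc-rep alu upx))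
    ... | false = subst (Anc s par u) (sym rep-parent) (⊴⇒par-anc-rep alu upx)
      where
      rep-parent : rep x ≡ rep (p x)
      rep-parent = rep-of (rep-alive (p x)) (up x≢s (rep-anc (p x)))
        (λ aly yx → rep-low aly (anc-parent yx (λ { refl → dead alx (rep-fix aly) })))

    ⊴⇒properAnc : ∀ {u v} → al u ≡ true → al v ≡ true → u ⊴ v → u ≢ v → ProperAnc s par u v
    ⊴⇒properAnc {u} {v} alu alv uv u≢v =
      anc⇒properAnc (anc-≢start uv u≢v)
        (subst (Anc s par u) (sym (par-rep v)) (⊴⇒par-anc-rep alu (anc-parent uv u≢v)))

    properAnc⇒⊴ : ∀ {u v} → ProperAnc s par u v → v ≢ s × u ⊴ par v
    properAnc⇒⊴ uv with properAnc⇒anc uv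
    ... | v≢s , upv = v≢s , par-anc⇒⊴ upv

    treeOrForward⇒⊴ : ∀ {u v} → TreeArc s par u v ⊎ ForwardArc s par u v → v ≢ s × u ⊴ par v
    treeOrForward⇒⊴ (inj₁ (v≢s , refl)) = v≢s , self
    treeOrForward⇒⊴ (inj₂ (v≢s , upv)) with properAnc⇒anc upv
    ... | pv≢s , uppv = v≢s , par-anc⇒⊴ (up pv≢s uppv)

    ⊴⇒treeOrForward : ∀ {u v} → al u ≡ true → al v ≡ true → u ⊴ v → u ≢ v →
      TreeArc s par u v ⊎ ForwardArc s par u v
    ⊴⇒treeOrForward {u} {v} alu alv uv u≢v with u ≟ par v
    ... | yes u≡pv = inj₁ (anc-≢start uv u≢v , u≡pv)
    ... | no u≢pv = inj₂ (anc-≢start uv u≢v , ⊴⇒properAnc alu (par-alive v) (par-low alu uv u≢v) u≢pv)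

    properAnc? : ∀ u v → Dec (ProperAnc s par u v)
    properAnc? u v = map′ (λ (v≢s , upv) → anc⇒properAnc v≢s upv) properAnc⇒anc
      (¬? (v ≟ s) ×-dec anc? num par-up u (par v))

    treeOrForward? : ∀ u v → Dec (TreeArc s par u v ⊎ ForwardArc s par u v)
    treeOrForward? u v =
      (¬? (v ≟ s) ×-dec (u ≟ par v)) ⊎-dec (¬? (v ≟ s) ×-dec properAnc? u (par v))

  open BaseProperties

  -- Contracting a vertex and marking an arc.

  renameEnd-hit : ∀ {v q : Fin n} → renameEnd v q v ≡ q
  renameEnd-hit {v} with v ≟ v
  ... | yes _ = refl
  ... | no v≢v = contradiction refl v≢v

  renameEnd-miss : ∀ {v q z : Fin n} → z ≢ v → renameEnd v q z ≡ z
  renameEnd-miss {v} {z = z} z≢v with z ≟ v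
  ... | yes z≡v = contradiction z≡v z≢v
  ... | no _ = refl

  still-alive : ∀ {al : Fin n → Bool} {v w} → upd al v false w ≡ true → al w ≡ true × w ≢ v
  still-alive {al} {v} {w} alw with w ≟ v
  ... | yes _ = contradiction alw (λ ())
  ... | no w≢v = alw , w≢v

  -- Shared by both loops. `v-avoidable` maintains `dead-av` for the vertex that dies;
  -- `parent-avoidable` maintains `late-tail` for the arcs whose tail moves from `v` to `par v`.
  module Contract {al par E k bound rep F} (B : Base al par E k bound rep F)
    {u v : Fin n} (Nu≡k : N u ≡ k) (v-alive : al v ≡ true) (v≢s : v ≢ s) (u⊴q : u ⊴ par v)
    (v-avoidable : ∀ {w} → al w ≡ true → v ⊴ w → v ≢ w → Av v w)
    (parent-avoidable : N (par v) < bound → Av (par v) v) where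

    q : Fin n
    q = par v

    al′ : Fin n → Bool
    al′ = upd al v false

    rep′ : Fin n → Fin n
    rep′ x = renameEnd v q (rep x)

    rep′-hit : ∀ {x} → rep x ≡ v → rep′ x ≡ q
    rep′-hit eq = trans (cong (renameEnd v q) eq) (renameEnd-hit {v})

    rep′-miss : ∀ {x} → rep x ≢ v → rep′ x ≡ rep x
    rep′-miss = renameEnd-miss

    private
      rep′-cases : ∀ x → (rep x ≡ v × rep′ x ≡ q) ⊎ (rep x ≢ v × rep′ x ≡ rep x)
      rep′-cases x with rep x ≟ v
      ... | yes eq = inj₁ (eq , refl)
      ... | no neq = inj₂ (neq , refl)

      alive′ : ∀ x → al′ (rep′ x) ≡ true
      alive′ x with rep′-cases x
      ... | inj₁ (_ , eq) rewrite eq = trans (upd-other al false (par-≢ B v≢s)) (par-alive B v)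
      ... | inj₂ (neq , eq) rewrite eq = trans (upd-other al false neq) (rep-alive B x)

      fix′ : ∀ {x} → al′ x ≡ true → rep′ x ≡ x
      fix′ {x} alx with still-alive {al} alx
      ... | alx′ , x≢v = trans (rep′-miss (λ eq → x≢v (trans (sym (rep-fix B alx′)) eq))) (rep-fix B alx′)

      anc′ : ∀ x → rep′ x ⊴ x
      anc′ x with rep′-cases x
      ... | inj₁ (refl , eq) rewrite eq = anc-trans (par-anc B v≢s) (rep-anc B x)
      ... | inj₂ (_ , eq) rewrite eq = rep-anc B x

      low′ : ∀ {x y} → al′ y ≡ true → y ⊴ x → y ⊴ rep′ x
      low′ {x} aly yx with still-alive {al} aly | rep′-cases x
      ... | aly′ , y≢v | inj₁ (refl , eq) rewrite eq = par-low B aly′ (rep-low B aly′ yx) y≢v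
      ... | aly′ , y≢v | inj₂ (_ , eq) rewrite eq = rep-low B aly′ yx

      arcs′ : ∀ F → contractArcs v q (map (both rep) F) ≡ map (both rep′) F
      arcs′ [] = refl
      arcs′ ((a , b) ∷ F) = cong (_ ∷_) (arcs′ F)

      closed′ : ∀ {a b} → (a , b) ∈ A → (a , b) ∈ F ⊎ Closed k rep′ a b
      closed′ {a} {b} ab with closed B ab
      ... | inj₁ ab∈F = inj₁ ab∈F
      -- `rep′ a` survives and is an ancestor of `b`, hence of the new nearest surviving ancestor of
      -- `b`.
      ... | inj₂ (common , ra⊴rb) = inj₂ (common ,
        low′ (alive′ a) (anc-trans (rep′⊴rep a) (anc-trans ra⊴rb (rep-anc B b))))
        where
        rep′⊴rep : ∀ x → rep′ x ⊴ rep x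
        rep′⊴rep x with rep′-cases x
        ... | inj₁ (refl , eq) rewrite eq = par-anc B v≢s
        ... | inj₂ (_ , eq) rewrite eq = self

      moved′ : ∀ x → rep′ x ≢ x → N (rep′ x) ≤ k
      moved′ x neq with rep′-cases x
      ... | inj₁ (_ , eq) rewrite eq = subst (_ ≤_) Nu≡k (⊴-N u⊴q)
      ... | inj₂ (_ , eq) rewrite eq = moved-low B x neq

      dead′ : ∀ {z w} → al′ z ≡ false → al′ w ≡ true → z ⊴ w → Av z w
      dead′ {z} {w} alz alw zw with still-alive {al} alw | z ≟ v
      ... | alw′ , w≢v | yes refl = v-avoidable alw′ zw (≢-sym w≢v)
      ... | alw′ , w≢v | no z≢v = dead-av B alz alw′ zw

      tail′ : ∀ {a b} → (a , b) ∈ F → N (rep′ a) < bound → rep′ a ⊴ b → rep′ a ≢ rep′ b →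
        Av (rep′ a) a
      tail′ {a} {b} ab lt a⊴b a≢b with rep′-cases a
      ... | inj₁ (refl , eq) rewrite eq =
        down (parent-avoidable lt) (rep-anc B a)
          (λ vq _ → par-≢ B v≢s (⊴-antisym (par-anc B v≢s) vq))
      ... | inj₂ (neq , eq) rewrite eq =
        late-tail B ab lt a⊴b
          (λ eqab → a≢b (trans eqab (sym (rep′-miss (λ bv → neq (trans eqab bv))))))

    contracted : Base al′ (contractPar par v) (contractArcs v q E) k bound rep′ F
    contracted = record
      { rep-alive = alive′
      ; rep-fix = fix′
      ; rep-anc = anc′
      ; rep-low = low′
      ; par-rep = λ x → cong (renameEnd v q) (par-rep B x)
      ; arcs-map = trans (cong (contractArcs v q) (arcs-map B)) (arcs′ F)
      ; F⊆A = F⊆A B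
      ; closed = closed′
      ; moved-low = moved′
      ; dead-av = dead′
      ; late-tail = tail′
      }

  -- Several unmarked arcs may have the image `(x , y)` and only one is removed, so the last
  -- component leaves open which arcs with that image remain.
  mark : ∀ {al par E k bound rep F x y u} → Base al par E k bound rep F → (e : (x , y) ∈ E) →
    N u ≤ k → u ⊴ x → x ⊴ y →
    ∃ λ F′ → Base al par (E ─ e) k bound rep F′ × (∀ {a b} → (a , b) ∈ F′ → (a , b) ∈ F) ×
      (∀ {a b} → (a , b) ∈ F → (a , b) ∈ F′ ⊎ (rep a ≡ x × rep b ≡ y))
  mark {k = k} {rep = rep} {F = F} {u = u} B e Nu≤k ux xy with refl ← arcs-map B with map-─ (both rep) F e
  ... | (a₀ , b₀) , e′ , refl , eqs = (F ─ e′) , marked , ─-⊆ e′ , λ ab → split ab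
    where
    split : ∀ {a b} → (a , b) ∈ F → (a , b) ∈ (F ─ e′) ⊎ (rep a ≡ rep a₀ × rep b ≡ rep b₀)
    split ab with ∈-─ e′ ab
    ... | inj₁ ab∈ = inj₁ ab∈
    ... | inj₂ refl = inj₂ (refl , refl)
    closed′ : ∀ {a b} → (a , b) ∈ A → (a , b) ∈ (F ─ e′) ⊎ Closed k rep a b
    closed′ {a} {b} ab with closed B ab
    ... | inj₂ c = inj₂ c
    ... | inj₁ ab∈F with ∈-─ e′ ab∈F
    ...   | inj₁ ab∈ = inj₁ ab∈
    ...   | inj₂ refl = inj₂ ((u , Nu≤k , anc-trans ux (rep-anc B a₀) ,
                               anc-trans ux (anc-trans xy (rep-anc B b₀))) , xy)
    marked : Base _ _ _ _ _ rep (F ─ e′)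
    marked = record
      { rep-alive = rep-alive B
      ; rep-fix = rep-fix B
      ; rep-anc = rep-anc B
      ; rep-low = rep-low B
      ; par-rep = par-rep B
      ; arcs-map = eqs
      ; F⊆A = λ ab → F⊆A B (─-⊆ e′ ab)
      ; closed = closed′
      ; moved-low = moved-low B
      ; dead-av = dead-av B
      ; late-tail = λ ab → late-tail B (─-⊆ e′ ab)
      }

  -- Invariants of the two loops.

  -- Supplies the entry that the induction in `Bypass` follows backwards out of the subtree of `v`.
  InArc : (Fin n → Bool) → (Fin n → Fin n) → List (Arc n) → Set
  InArc al rep F = ∀ {v} → al v ≡ true → v ≢ s →
    ∃ λ a → ∃ λ b → (a , b) ∈ F × rep b ≡ v × ¬ v ⊴ a

  -- What a path from `x` to `r` inside the subtree of `r` provides; the path itself is not stored.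
  LeadsTo : Fin n → Fin n → Set
  LeadsTo x r = ∀ {z} → ¬ r ⊴ z → Av z x → Av z r

  -- `entry` is what makes the current vertex dominate the class merged into it; it starts out
  -- vacuous, as nothing has been merged into that vertex yet. `no-back` lets every unmarked arc
  -- into a processed vertex serve as an entry for `InArc`.
  record OutInv (al : Fin n → Bool) (k : ℕ) (rep : Fin n → Fin n) (F : List (Arc n)) : Set where
    field
      entry    : ∀ {u c x} → N u ≡ k → (c , x) ∈ A → rep x ≡ u → x ≢ u → rep c ≡ u
      reach    : ∀ {c x} → (c , x) ∈ F → LeadsTo x (rep x)
      no-back  : ∀ {a b} → (a , b) ∈ F → N (rep b) < k → ¬ rep b ⊴ a
      complete : k ≡ n → ∀ {v} → al v ≡ true → v ≡ s

  Pending : Fin n → (Fin n → Fin n) → List (Arc n) → Fin n → Set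
  Pending u rep F y =
    u ⊴ y × u ≢ y × ∃ λ a → ∃ λ b → (a , b) ∈ F × rep a ≡ y × rep b ≡ u

  -- While the back arcs into u are processed, reach and no-back may fail at a vertex y, but only
  -- if an arc (y , u) is left, so that y will be contracted as well before the phase ends.
  record InInv (al : Fin n → Bool) (k : ℕ) (rep : Fin n → Fin n) (F : List (Arc n)) : Set where
    field
      current   : Fin n
      N-current : N current ≡ k
      bypass    : ∀ {v z} → al v ≡ true → current ⊴ v → current ≢ v → current ⊴ z → z ≢ v → Av z v
      reach     : ∀ {c x} → (c , x) ∈ F →
                  LeadsTo x (rep x) ⊎ (Pending current rep F (rep x) × LeadsTo x current)
      no-back   : ∀ {a b} → (a , b) ∈ F → N (rep b) < k →
                  ¬ rep b ⊴ a ⊎ Pending current rep F (rep b)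

  -- The bypass property.

  module Bypass {al par E k bound rep F} (B : Base al par E k bound rep F) (k≤bound : k ≤ bound)
    (in-arc : InArc al rep F) (reach : ∀ {c x} → (c , x) ∈ F → LeadsTo x (rep x))
    {u : Fin n} (Nu≡k : N u ≡ k) where

    NoOutArc : Set
    NoOutArc = ∀ {a b} → (a , b) ∈ F → rep a ≡ u → u ⊴ b → rep b ≢ u → ⊥

    -- The path to v goes through an arc (a , b) into the class of v from outside its subtree;
    -- rep a has smaller rank than v.
    private
      bypass-acc : ∀ {v z} → Acc _<_ (rank v) → al v ≡ true → u ⊴ v → u ≢ v → u ⊴ z → z ≢ v →
        (z ≡ u → NoOutArc) → Av z v
      bypass-acc {v} {z} (acc rs) alv uv u≢v uz z≢v noOut = av-dec goal
        where
        goal : z ⊴ v → Av z v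
        goal zv with al z in alz
        ... | false = dead-av B alz alv zv
        ... | true with in-arc alv (anc-≢start uv u≢v)
        ...   | a , b , ab , refl , ¬va =
          reach ab (λ vz → z≢v (⊴-antisym zv vz))
            (ext av-a (F⊆A B ab) (λ { refl → z≢v (sym (rep-fix B alz)) }))
          where
          x : Fin n
          x = rep a
          x⊴a : x ⊴ a
          x⊴a = rep-anc B a
          alu : al u ≡ true
          alu = current-alive B Nu≡k
          to-a : x ≢ z → Av z x → Av z a
          to-a x≢z av = down av x⊴a (λ xz za → x≢z (⊴-antisym xz (rep-low B alz za)))
          av-a : Av z a
          av-a = av-dec (λ za → cases (rep-low B alz za))
            where
            cases : z ⊴ x → Av z a
            cases zx with x ≟ z | x ≟ u
            ... | yes refl | yes refl = ⊥-elim (noOut refl ab refl (anc-trans uv (rep-anc B b)) (≢-sym u≢v))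
            -- Here `z` is `rep a` itself, a proper descendant of `u`, so its number is below `k`
            -- and its first loop is over.
            ... | yes refl | no x≢u =
              late-tail B ab (<-≤-trans (subst (N x <_) Nu≡k (⊴-N-< uz (≢-sym x≢u))) k≤bound)
                (anc-trans zv (rep-anc B b)) z≢v
            ... | no x≢z | yes refl = contradiction (⊴-antisym uz zx) x≢z
            ... | no x≢z | no x≢u =
              to-a x≢z (bypass-acc (rs (rank-enter (F⊆A B ab) x⊴a (rep-anc B b) ¬va))
                (rep-alive B a) (anc-trans uz zx) (≢-sym x≢u) uz (≢-sym x≢z) noOut)

    bypass : ∀ {v z} → al v ≡ true → u ⊴ v → u ≢ v → u ⊴ z → z ≢ v → (z ≡ u → NoOutArc) → Av z v
    bypass = bypass-acc (<-wellFounded _)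

  -- The sets `same` and the assignment of dominators.

  any-∈ : ∀ {w : Fin n} {ws} → w ∈ ws → any (λ y → ⌊ w ≟ y ⌋) ws ≡ true
  any-∈ {w} {y ∷ ws} w∈ with w ≟ y
  ... | yes _ = refl
  any-∈ (here w≡y) | no w≢y = contradiction w≡y w≢y
  any-∈ (there w∈) | no _ = any-∈ w∈

  any-∉ : ∀ {w : Fin n} {ws} → w ∉ ws → any (λ y → ⌊ w ≟ y ⌋) ws ≡ false
  any-∉ {ws = []} _ = refl
  any-∉ {w} {y ∷ ws} w∉ with w ≟ y
  ... | yes w≡y = contradiction (here w≡y) w∉
  ... | no _ = any-∉ (w∉ ∘ there)

  -- `same-idom` is conditional because the immediate dominator of a surviving vertex is not known
  -- yet; `resolve-labels` discharges the condition.
  record Labels (al : Fin n → Bool) (sm : Fin n → List (Fin n)) (dm : Fin n → Maybe (Fin n)) : Set where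
    field
      same-idom : ∀ {v w} → w ∈ sm v → ∀ {x} → Idom x v → Idom x w
      covered   : ∀ {w} → w ≢ s →
        (∃ λ x → dm w ≡ just x × Idom x w) ⊎ (∃ λ v → al v ≡ true × v ≢ s × w ∈ sm v)

  open Labels

  -- Serves both loops: `t` is `par v` in the first and the current vertex in the second.
  merge-labels : ∀ {al sm dm v t} → Labels al sm dm → al t ≡ true → t ≢ v → t ≢ s →
    (∀ {x} → Idom x t → Idom x v) → Labels (upd al v false) (upd sm t (sm t ++ sm v)) dm
  merge-labels {al} {sm} {dm} {v} {t} L alt t≢v t≢s inherit = record
    { same-idom = idom′ ; covered = covered′ }
    where
    sm′ : Fin n → List (Fin n)
    sm′ = upd sm t (sm t ++ sm v)
    idom′ : ∀ {y w} → w ∈ sm′ y → ∀ {x} → Idom x y → Idom x w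
    idom′ {y} w∈ id with y ≟ t
    ... | no _ = same-idom L w∈ id
    ... | yes refl with ∈-++⁻ (sm t) w∈
    ...   | inj₁ w∈t = same-idom L w∈t id
    ...   | inj₂ w∈v = same-idom L w∈v (inherit id)
    t-alive : upd al v false t ≡ true
    t-alive = trans (upd-other al false t≢v) alt
    in-t : ∀ {w} → w ∈ sm t ++ sm v → w ∈ sm′ t
    in-t {w} = subst (w ∈_) (sym (upd-same sm t _))
    covered′ : ∀ {w} → w ≢ s →
      (∃ λ x → dm w ≡ just x × Idom x w) ⊎ (∃ λ y → upd al v false y ≡ true × y ≢ s × w ∈ sm′ y)
    covered′ {w} w≢s with covered L w≢s
    ... | inj₁ found = inj₁ found
    ... | inj₂ (y , aly , y≢s , w∈y) with y ≟ v | y ≟ t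
    ...   | yes refl | _ = inj₂ (t , t-alive , t≢s , in-t (∈-++⁺ʳ (sm t) w∈y))
    ...   | no _ | yes refl = inj₂ (t , t-alive , t≢s , in-t (∈-++⁺ˡ w∈y))
    ...   | no y≢v | no y≢t = inj₂ (y , trans (upd-other al false y≢v) aly , y≢s ,
                                    subst (w ∈_) (sym (upd-other sm _ y≢t)) w∈y)

  resolve-labels : ∀ {al sm dm v u} → Labels al sm dm → Idom u v →
    Labels (upd al v false) sm (setDom dm (sm v) u)
  resolve-labels {al} {sm} {dm} {v} {u} L uv = record
    { same-idom = same-idom L ; covered = covered′ }
    where
    covered′ : ∀ {w} → w ≢ s → (∃ λ x → setDom dm (sm v) u w ≡ just x × Idom x w) ⊎
      (∃ λ y → upd al v false y ≡ true × y ≢ s × w ∈ sm y)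
    covered′ {w} w≢s with DecMembership._∈?_ _≟_ w (sm v)
    ... | yes w∈v rewrite any-∈ w∈v = inj₁ (u , refl , same-idom L w∈v uv)
    ... | no w∉v rewrite any-∉ w∉v with covered L w≢s
    ...   | inj₁ found = inj₁ found
    ...   | inj₂ (y , aly , y≢s , w∈y) =
      inj₂ (y , trans (upd-other al false (λ { refl → w∉v w∈y })) aly , y≢s , w∈y)

  -- The combined invariant.

  -- In the second loop the current vertex has itself completed its first loop, hence the `suc`.
  bound : Phase → ℕ → ℕ
  bound outArcs k = k
  bound inArcs  k = suc k

  PhaseInv : Phase → (Fin n → Bool) → ℕ → (Fin n → Fin n) → List (Arc n) → Set
  PhaseInv outArcs = OutInv
  PhaseInv inArcs  = InInv

  record Inv (st : GDState n) : Set where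
    constructor mkInv
    open GDState st
    field
      {rep}    : Fin n → Fin n
      {F}      : List (Arc n)
      base     : Base alive par arcs index (bound phase index) rep F
      in-arc   : InArc alive rep F
      labels   : Labels alive same dom
      in-range : index ≤ n
      phase-inv : PhaseInv phase alive index rep F

  -- Contractions in the first loop.

  -- The first loop finishes v at u: all its in-arcs are marked.  B is the situation before the
  -- last of them, F′ and marked describe the situation after it.
  module Finish {al par E E′ k rep F F′} (B : Base al par E k k rep F) (in-arc : InArc al rep F)
    (out : OutInv al k rep F) (marked : Base al par E′ k k rep F′)
    (F′⊆F : ∀ {a b} → (a , b) ∈ F′ → (a , b) ∈ F)
    {u v : Fin n} (kept : ∀ {a b} → (a , b) ∈ F → (a , b) ∈ F′ ⊎ (rep a ≡ u × rep b ≡ v))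
    (Nu≡k : N u ≡ k) (v-alive : al v ≡ true) (v≢s : v ≢ s) (u⊴q : u ⊴ par v)
    (no-in-arc : ∀ {a b} → (a , b) ∈ F′ → rep b ≢ v) where

    open OutInv out
    open Bypass B ≤-refl in-arc reach Nu≡k using (bypass)

    private
      q : Fin n
      q = par v
      u-alive : al u ≡ true
      u-alive = current-alive B Nu≡k
      q⊴v : q ⊴ v
      q⊴v = par-anc B v≢s
      u⊴v : u ⊴ v
      u⊴v = anc-trans u⊴q q⊴v
      q≢v : q ≢ v
      q≢v = par-≢ B v≢s
      u≢v : u ≢ v
      u≢v refl = q≢v (⊴-antisym q⊴v u⊴q)
      bypass-v : ∀ {z} → u ⊴ z → z ≢ u → z ≢ v → Av z v
      bypass-v uz z≢u z≢v = bypass v-alive u⊴v u≢v uz z≢v (λ z≡u → contradiction z≡u z≢u)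

      v-avoidable : ∀ {w} → al w ≡ true → v ⊴ w → v ≢ w → Av v w
      v-avoidable alw vw v≢w = bypass alw (anc-trans u⊴v vw) (≢-between u⊴v vw u≢v) u⊴v v≢w
        (λ v≡u → contradiction (sym v≡u) u≢v)
      parent-avoidable : N q < k → Av q v
      parent-avoidable lt = bypass-v u⊴q (λ { refl → <-irrefl Nu≡k lt }) q≢v

    open Contract marked Nu≡k v-alive v≢s u⊴q v-avoidable parent-avoidable
      public using (rep′; rep′-hit; rep′-miss; contracted)

    -- The vertex that witnesses `Closed` is an ancestor of `b`, as is `u`, and its number is at
    -- most that of `u`; so it lies in the subtree of `u`, and `a` with it.
    closed-tail : ∀ {a b} → u ⊴ b → Closed k rep a b → u ⊴ a
    closed-tail ub ((u′ , le , u′a , u′b) , _) =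
      anc-trans (⊴-of-lower ub u′b (subst (_ ≤_) (sym Nu≡k) le)) u′a

    private
      rep′-kept : ∀ {a b} → (a , b) ∈ F′ → rep′ b ≡ rep b
      rep′-kept ab = rep′-miss (no-in-arc ab)

      -- When `v` joins the class of `u`, every arc into the class of `v` is marked. The
      -- representative of its tail lies between `u` and `v`, and nothing survives strictly between
      -- `par v` and `v`.
      entry′ : ∀ {c x} → (c , x) ∈ A → rep′ x ≡ u → x ≢ u → rep′ c ≡ u
      entry′ {c} {x} cx x↦u x≢u with rep x ≟ v
      ... | no rx≢v = trans (cong (renameEnd v q) (entry Nu≡k cx x↦u x≢u)) (renameEnd-miss u≢v)
      ... | yes rx≡v with closed marked cx
      ...   | inj₁ cx∈F′ = contradiction rx≡v (no-in-arc cx∈F′)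
      ...   | inj₂ cl with rep c ≟ v
      ...     | yes _ = x↦u
      ...     | no rc≢v = ⊴-antisym
        (subst (rep c ⊴_) x↦u
          (par-low B (rep-alive B c) (subst (rep c ⊴_) rx≡v (proj₂ cl)) rc≢v))
        (rep-low B u-alive (closed-tail (anc-trans u⊴v (subst (_⊴ x) rx≡v (rep-anc B x))) cl))

    out′ : OutInv (upd al v false) k rep′ F′
    out′ = record
      { entry = entry″
      ; reach = λ {c} {x} cx {z} → subst (λ r → ¬ r ⊴ z → Av z x → Av z r) (sym (rep′-kept cx)) (reach (F′⊆F cx))
      ; no-back = λ {a} {b} ab → subst (λ r → N r < k → ¬ r ⊴ a) (sym (rep′-kept ab)) (no-back (F′⊆F ab))
      ; complete = λ k≡n alw → complete k≡n (proj₁ (still-alive {al} alw))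
      }
      where
      entry″ : ∀ {u₁ c x} → N u₁ ≡ k → (c , x) ∈ A → rep′ x ≡ u₁ → x ≢ u₁ → rep′ c ≡ u₁
      entry″ Nu₁≡k with N-injective (trans Nu₁≡k (sym Nu≡k))
      ... | refl = entry′

    in-arc′ : InArc (upd al v false) rep′ F′
    in-arc′ {w} alw w≢s with still-alive {al} alw
    ... | alw′ , w≢v with in-arc alw′ w≢s
    ...   | a , b , ab , refl , ¬wa with kept ab
    ...     | inj₁ ab∈F′ = a , b , ab∈F′ , rep′-miss w≢v , ¬wa
    ...     | inj₂ (_ , rb≡v) = contradiction rb≡v w≢v

    -- By `entry′` a path can enter the merged class, which now contains `v`, only at `u`.
    -- Conversely, a path to `u` avoiding `z` extends down the tree unless `z` is below `u`, where
    -- `bypass-v` applies.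
    idom-parent : u ≡ q → Idom u v
    idom-parent u≡q = mkIdom u≢v (λ av → outside av (trans (rep′-hit (rep-fix B v-alive)) (sym u≡q))) closest
      where
      outside : ∀ {a} → Av u a → rep′ a ≢ u
      outside (root s≢u) s↦u = s≢u (trans (sym (trans (rep′-miss (λ rs≡v → v≢s (trans (sym rs≡v) s-fixed))) s-fixed)) s↦u)
        where
        s-fixed : rep s ≡ s
        s-fixed = rep-fix B (start-alive B)
      outside (ext av ab b≢u) b↦u = outside av (entry′ ab b↦u b≢u)
      closest : ∀ {z} → z ≢ v → Av z u → Av z v
      closest {z} z≢v av with anc? num num-up u z
      ... | yes uz = bypass-v uz (≢-sym (av-≢ av)) z≢v
      ... | no ¬uz = down av u⊴v (λ uz _ → ¬uz uz)

    -- A path to `v` avoiding `x` is traced back until it can be diverted to `q` (`through`). For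
    -- `closest′`, `bypass-v` covers a `z` strictly below `u`, and the tree arcs down from `q` to
    -- `v` cover the rest.
    idom-inherit : u ≢ q → ∀ {x} → Idom x q → Idom x v
    idom-inherit u≢q {x} (mkIdom x≢q dominates closest) =
      mkIdom (≢-sym (λ v≡x → dominates (av-outside (λ xq → q≢v (⊴-antisym q⊴v (subst (_⊴ q) (sym v≡x) xq))))))
        (λ av → dominates (through av u⊴v (subst (_⊴ v) (sym (rep-fix B v-alive)) self)))
        closest′
      where
      q-alive : al q ≡ true
      q-alive = par-alive B v
      bypass-q : ∀ {z} → u ⊴ z → z ≢ u → z ≢ q → Av z q
      bypass-q uz z≢u z≢q = bypass q-alive u⊴q u≢q uz z≢q (λ z≡u → contradiction z≡u z≢u)
      x⊴u : x ⊴ u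
      x⊴u with anc? num num-up x q
      ... | no ¬xq = contradiction (av-outside ¬xq) dominates
      ... | yes xq with anc-comparable xq u⊴q
      ...   | inj₁ xu = xu
      ...   | inj₂ ux with x ≟ u
      ...     | yes refl = self
      ...     | no x≢u = contradiction (bypass-q ux x≢u x≢q) dominates
      to-q : ∀ {r} → Av x r → u ⊴ r → r ⊴ q → Av x q
      to-q av ur rq = down av rq (λ rx _ → av-≢ av (⊴-antisym rx (anc-trans x⊴u ur)))
      -- The path is followed backwards. Inside the class of `u` it goes back to `u` itself, from
      -- where the tree leads to `q`. At an unmarked arc `reach` leads to `rep a`, which is not `v`
      -- and so is an ancestor of `q`. At a marked arc the search continues from the tail.
      through : ∀ {a} → Av x a → u ⊴ a → rep a ⊴ v → Av x q
      through (root s≢x) us _ with anc-start us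
      ... | refl = contradiction (sym (anc-start x⊴u)) s≢x
      through {a} (ext {a = c} av ca a≢x) ua rav with rep a ≟ u
      ... | yes ra≡u with a ≟ u
      ...   | yes refl = to-q (ext av ca a≢x) self u⊴q
      ...   | no a≢u = through av (subst (_⊴ c) rc≡u (rep-anc B c)) (subst (_⊴ v) (sym rc≡u) u⊴v)
        where
        rc≡u : rep c ≡ u
        rc≡u = entry Nu≡k ca ra≡u a≢u
      through {a} (ext {a = c} av ca a≢x) ua rav | no ra≢u with closed marked ca
      ... | inj₁ ca∈F′ = to-q (reach (F′⊆F ca∈F′) (λ rx → ra≢u (⊴-antisym (anc-trans rx x⊴u) ura)) (ext av ca a≢x))
                              ura (par-low B (rep-alive B a) rav (no-in-arc ca∈F′))
        where
        ura : u ⊴ rep a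
        ura = rep-low B u-alive ua
      ... | inj₂ cl = through av (closed-tail ua cl) (anc-trans (proj₂ cl) rav)
      closest′ : ∀ {z} → z ≢ v → Av z x → Av z v
      closest′ {z} z≢v av with anc? num num-up u z
      ... | no ¬uz = down (closest (λ { refl → ¬uz u⊴q }) av) q⊴v (λ qz _ → ¬uz (anc-trans u⊴q qz))
      ... | yes uz with z ≟ u
      ...   | no z≢u = bypass-v uz z≢u z≢v
      ...   | yes refl = down (closest u≢q av) q⊴v (λ qz _ → u≢q (⊴-antisym u⊴q qz))

  -- Contractions in the second loop.

  module Absorb {al par E k rep F} (B : Base al par E k (suc k) rep F) (in-arc : InArc al rep F)
    (inv : InInv al k rep F) {v : Fin n} (arc : (v , InInv.current inv) ∈ E) (v≢s : v ≢ s)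
    (u⊴q : InInv.current inv ⊴ par v) (v≢u : v ≢ InInv.current inv) where

    open InInv inv renaming (current to u; N-current to Nu≡k)

    private
      q : Fin n
      q = par v
      v-alive : al v ≡ true
      v-alive = tail-alive B arc
      q⊴v : q ⊴ v
      q⊴v = par-anc B v≢s
      u⊴v : u ⊴ v
      u⊴v = anc-trans u⊴q q⊴v
      u≢v : u ≢ v
      u≢v = ≢-sym v≢u

      v-avoidable : ∀ {w} → al w ≡ true → v ⊴ w → v ≢ w → Av v w
      v-avoidable alw vw v≢w = bypass alw (anc-trans u⊴v vw) (≢-between u⊴v vw u≢v) u⊴v v≢w
      parent-avoidable : N q < suc k → Av q v
      parent-avoidable _ = bypass v-alive u⊴v u≢v u⊴q (par-≢ B v≢s)

    open Contract B Nu≡k v-alive v≢s u⊴q v-avoidable parent-avoidable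
      public using (rep′; rep′-hit; rep′-miss; contracted)

    private
      u-fixed : ∀ {b} → rep b ≡ u → rep′ b ≡ u
      u-fixed rb≡u = trans (rep′-miss (λ rb≡v → u≢v (trans (sym rb≡u) rb≡v))) rb≡u

      -- Contraction turns the arc from `v` to `u` into one from `par v` to `u`, which excuses a
      -- failure of `reach` or `no-back` at `par v`.
      v-pending : q ≢ u → Pending u rep′ F q
      v-pending q≢u with arc-preimage B arc
      ... | a , b , ab , ra≡v , rb≡u = u⊴q , ≢-sym q≢u , a , b , ab , rep′-hit ra≡v , u-fixed rb≡u

      other-pending : ∀ {y} → y ≢ v → Pending u rep F y → Pending u rep′ F y
      other-pending y≢v (uy , u≢y , a , b , ab , ra≡y , rb≡u) =
        uy , u≢y , a , b , ab , trans (rep′-miss (λ ra≡v → y≢v (trans (sym ra≡y) ra≡v))) ra≡y , u-fixed rb≡u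

      to-head : ∀ {z x} → ¬ u ⊴ z → LeadsTo x (rep x) ⊎ (Pending u rep F (rep x) × LeadsTo x u) →
        rep x ≡ u → Av z x → Av z u
      to-head ¬uz (inj₁ leads) refl av = leads ¬uz av
      to-head ¬uz (inj₂ (_ , leads)) _ av = leads ¬uz av

    -- Down the tree from `v` to the original tail `a`, across to `b`, and on to `u` by `reach`; a
    -- `z` outside the subtree of `u` blocks none of these pieces.
    v-leads : LeadsTo v u
    v-leads {z} ¬uz av with arc-preimage B arc
    ... | a , b , ab , refl , rb≡u =
      to-head ¬uz (reach ab) rb≡u
        (ext (down av (rep-anc B a) (λ vz _ → ¬uz (anc-trans u⊴v vz))) (F⊆A B ab)
          (λ { refl → ¬uz (subst (_⊴ b) rb≡u (rep-anc B b)) }))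

    private
      reach′ : ∀ {c x} → (c , x) ∈ F →
        LeadsTo x (rep′ x) ⊎ (Pending u rep′ F (rep′ x) × LeadsTo x u)
      reach′ {c} {x} cx with rep x ≟ v | reach cx
      ... | no _   | inj₁ leads = inj₁ leads
      ... | no rx≢v | inj₂ (pending , leads) = inj₂ (other-pending rx≢v pending , leads)
      ... | yes rx≡v | old = via-u
        where
        leads : LeadsTo x u
        leads ¬uz av =
          [ (λ here-leads → v-leads ¬uz (subst (Av _) rx≡v
              (here-leads (λ rz → ¬uz (anc-trans u⊴v (subst (_⊴ _) rx≡v rz))) av)))
          , (λ (_ , on) → on ¬uz av) ]′ old
        via-u : LeadsTo x q ⊎ (Pending u rep′ F q × LeadsTo x u)
        via-u with q ≟ u
        ... | yes q≡u = inj₁ (subst (LeadsTo x) (sym q≡u) leads)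
        ... | no q≢u = inj₂ (v-pending q≢u , leads)

      no-back′ : ∀ {a b} → (a , b) ∈ F → N (rep′ b) < k →
        ¬ rep′ b ⊴ a ⊎ Pending u rep′ F (rep′ b)
      no-back′ {a} {b} ab lt with rep b ≟ v
      ... | yes rb≡v = inj₂ (v-pending (λ { refl → <-irrefl Nu≡k lt }))
      ... | no rb≢v with no-back ab lt
      ...   | inj₁ ¬ba = inj₁ ¬ba
      ...   | inj₂ pending = inj₂ (other-pending rb≢v pending)

    inv′ : InInv (upd al v false) k rep′ F
    inv′ = record
      { current = u
      ; N-current = Nu≡k
      ; bypass = λ alw → bypass (proj₁ (still-alive {al} alw))
      ; reach = reach′
      ; no-back = no-back′
      }

    in-arc′ : InArc (upd al v false) rep′ F
    in-arc′ {w} alw w≢s with still-alive {al} alw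
    ... | alw′ , w≢v with in-arc alw′ w≢s
    ...   | a , b , ab , refl , ¬wa = a , b , ab , rep′-miss w≢v , ¬wa

    -- `v` can be reached without `u`, but nothing can be reached without `s`.
    u≢s : u ≢ s
    u≢s u≡s = ¬av-start (subst (λ z → Av z v) u≡s (bypass v-alive u⊴v u≢v self u≢v))

    -- For a vertex outside the subtree of `u`, avoiding paths pass from `v` to `u` by `v-leads` and
    -- from `u` to `v` down the tree. Vertices inside, other than `v`, are excluded as dominators of
    -- `v` by `bypass`.
    idom-inherit : ∀ {x} → Idom x u → Idom x v
    idom-inherit {x} (mkIdom x≢u dominates closest) =
      mkIdom (λ { refl → ¬ux u⊴v }) (λ av → dominates (v-leads ¬ux av)) closest′
      where
      ¬ux : ¬ u ⊴ x
      ¬ux ux = dominates (av-outside (λ xu → x≢u (⊴-antisym xu ux)))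
      closest′ : ∀ {z} → z ≢ v → Av z x → Av z v
      closest′ {z} z≢v av with anc? num num-up u z
      ... | yes uz = bypass v-alive u⊴v u≢v uz z≢v
      ... | no ¬uz = down (closest (λ { refl → ¬uz self }) av) u⊴v (λ uz _ → ¬uz uz)

  -- Preservation of the invariant.

  Step : GDState n → GDState n → Set
  Step = GDStep s num

  finish-image : ∀ {al par E k b rep F y} → Base al par E k b rep F → ¬ HasArcInto E y →
    ∀ {c d} → (c , d) ∈ F → rep d ≢ y
  finish-image B none cd refl = none (_ , arc-image B cd)

  preserve : ∀ {st st′} → Inv st → Step st st′ → Inv st′
  preserve (mkInv {rep} {F} B in-arc L k≤n out) (markOut-keep {E = E} {k = k} {u = u} {v = v} Nu≡k e form (x , xv))
    with treeOrForward⇒⊴ B form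
  ... | v≢s , u⊴q
    with mark B e (ℕₚ.≤-reflexive Nu≡k) self (anc-trans u⊴q (par-anc B v≢s))
  ... | F′ , B′ , F′⊆F , kept = mkInv B′ in-arc′ L k≤n (record
    { entry = entry
    ; reach = λ cx → reach (F′⊆F cx)
    ; no-back = λ ab → no-back (F′⊆F ab)
    ; complete = complete
    })
    where
    open OutInv out
    in-arc′ : InArc _ rep F′
    in-arc′ {w} alw w≢s with w ≟ v
    -- The arc into `v` that remains comes from outside the subtree of `v`: the number of `v` is
    -- below `k`, so `no-back` applies.
    ... | yes refl with arc-preimage B′ xv
    ...   | a , b , ab , _ , rb≡v =
      a , b , ab , rb≡v , subst (λ r → ¬ r ⊴ a) rb≡v (no-back (F′⊆F ab)
        (subst (λ r → N r < k) (sym rb≡v) (<-≤-trans (par-up B v v≢s) (subst (_ ≤_) Nu≡k (⊴-N u⊴q)))))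
    in-arc′ {w} alw w≢s | no w≢v with in-arc alw w≢s
    ... | a , b , ab , rb≡w , ¬wa with kept ab
    ...   | inj₁ ab∈F′ = a , b , ab∈F′ , rb≡w , ¬wa
    ...   | inj₂ (_ , rb≡v) = contradiction (trans (sym rb≡w) rb≡v) w≢v
  preserve (mkInv {rep} {F} B in-arc L k≤n out) (markOut-tree Nu≡k e form none u≡q)
    with treeOrForward⇒⊴ B form
  ... | v≢s , u⊴q
    with mark B e (ℕₚ.≤-reflexive Nu≡k) self (anc-trans u⊴q (par-anc B v≢s))
  ... | F′ , B′ , F′⊆F , kept =
    mkInv contracted in-arc′ (resolve-labels L (idom-parent u≡q)) k≤n out′
    where
    open Finish B in-arc out B′ F′⊆F kept Nu≡k (head-alive B e) v≢s u⊴q (finish-image B′ none)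
  preserve (mkInv {rep} {F} B in-arc L k≤n out) (markOut-fwd {u = u} {v = v} Nu≡k e form none u≢q)
    with treeOrForward⇒⊴ B form
  ... | v≢s , u⊴q
    with mark B e (ℕₚ.≤-reflexive Nu≡k) self (anc-trans u⊴q (par-anc B v≢s))
  ... | F′ , B′ , F′⊆F , kept =
    mkInv contracted in-arc′
      (merge-labels L (par-alive B v) (par-≢ B v≢s) (anc-≢start u⊴q u≢q) (idom-inherit u≢q))
      k≤n out′
    where
    open Finish B in-arc out B′ F′⊆F kept Nu≡k (head-alive B e) v≢s u⊴q (finish-image B′ none)
  preserve (mkInv {rep} {F} B in-arc L k≤n out) (outDone {k = k} {u = u} Nu≡k none) =
    mkInv B′ in-arc L k≤n (record
      { current = u
      ; N-current = Nu≡k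
      ; bypass = λ alv uv u≢v uz z≢v → bypass alv uv u≢v uz z≢v (λ _ → no-out)
      ; reach = λ cx → inj₁ (reach cx)
      ; no-back = λ ab lt → inj₁ (no-back ab lt)
      })
    where
    open OutInv out
    open Bypass B ≤-refl in-arc reach Nu≡k
    no-out : NoOutArc
    no-out {a} {b} ab refl ub rb≢u =
      none (arc-image B ab) (⊴⇒treeOrForward B (rep-alive B a) (rep-alive B b)
        (rep-low B (rep-alive B a) ub) (≢-sym rb≢u))
    late : ∀ {a b} → (a , b) ∈ F → N (rep a) < suc k → rep a ⊴ b → rep a ≢ rep b → Av (rep a) a
    late {a} ab (s≤s le) ra⊴b ra≢rb with N (rep a) ℕₚ.≟ k
    ... | no ≢k = late-tail B ab (ℕₚ.≤∧≢⇒< le ≢k) ra⊴b ra≢rb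
    -- The new case `rep a ≡ u` is vacuous, since the first loop has left no such arc at `u`.
    ... | yes ≡k with N-injective (trans ≡k (sym Nu≡k))
    ...   | ra≡u = ⊥-elim (no-out ab ra≡u (subst (_⊴ _) ra≡u ra⊴b) (λ rb≡u → ra≢rb (trans ra≡u (sym rb≡u))))
    B′ : Base _ _ _ k (suc k) rep F
    B′ = record
      { rep-alive = rep-alive B
      ; rep-fix = rep-fix B
      ; rep-anc = rep-anc B
      ; rep-low = rep-low B
      ; par-rep = par-rep B
      ; arcs-map = arcs-map B
      ; F⊆A = F⊆A B
      ; closed = closed B
      ; moved-low = moved-low B
      ; dead-av = dead-av B
      ; late-tail = late
      }
  preserve (mkInv {rep} {F} B in-arc L k≤n inv) (inLoop {u = u} Nu≡k e)
    with N-injective (trans Nu≡k (sym (InInv.N-current inv)))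
  ... | refl with mark B e (ℕₚ.≤-reflexive Nu≡k) self self
  ... | F′ , B′ , F′⊆F , kept = mkInv B′ in-arc′ L k≤n (record
    { current = u
    ; N-current = Nu≡k
    ; bypass = bypass
    ; reach = reach′
    ; no-back = no-back′
    })
    where
    open InInv inv using (bypass; reach; no-back)
    keep-pending : ∀ {y} → Pending u rep F y → Pending u rep F′ y
    keep-pending (uy , u≢y , a , b , ab , ra≡y , rb≡u) with kept ab
    ... | inj₁ ab∈F′ = uy , u≢y , a , b , ab∈F′ , ra≡y , rb≡u
    ... | inj₂ (ra≡u , _) = contradiction (trans (sym ra≡u) ra≡y) u≢y
    reach′ : ∀ {c x} → (c , x) ∈ F′ → LeadsTo x (rep x) ⊎ (Pending u rep F′ (rep x) × LeadsTo x u)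
    reach′ cx with reach (F′⊆F cx)
    ... | inj₁ leads = inj₁ leads
    ... | inj₂ (pending , leads) = inj₂ (keep-pending pending , leads)
    no-back′ : ∀ {a b} → (a , b) ∈ F′ → N (rep b) < _ → ¬ rep b ⊴ a ⊎ Pending u rep F′ (rep b)
    no-back′ ab lt with no-back (F′⊆F ab) lt
    ... | inj₁ ¬ba = inj₁ ¬ba
    ... | inj₂ pending = inj₂ (keep-pending pending)
    in-arc′ : InArc _ rep F′
    in-arc′ alw w≢s with in-arc alw w≢s
    ... | a , b , ab , refl , ¬wa with kept ab
    ...   | inj₁ ab∈F′ = a , b , ab∈F′ , refl , ¬wa
    -- The deleted loop arc has its tail below `u`, so it was not the chosen entry.
    ...   | inj₂ (ra≡u , rb≡u) =
      contradiction (subst (_⊴ a) (trans ra≡u (sym rb≡u)) (rep-anc B a)) ¬wa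
  preserve (mkInv {rep} {F} B in-arc L k≤n inv) (inBack {u = u} Nu≡k arc back v≢u)
    with N-injective (trans Nu≡k (sym (InInv.N-current inv)))
  ... | refl with properAnc⇒⊴ B back
  ... | v≢s , u⊴q =
    mkInv contracted in-arc′ (merge-labels L (head-alive B arc) (≢-sym v≢u) u≢s idom-inherit) k≤n inv′
    where
    open Absorb B in-arc inv arc v≢s u⊴q v≢u
  preserve (mkInv {rep} {F} B in-arc L k≤n inv) (inDone {al = al} {k = k} {u = u} Nu≡k none)
    with N-injective (trans Nu≡k (sym (InInv.N-current inv)))
  ... | refl = mkInv B′ in-arc L (subst (_< n) Nu≡k (toℕ<n (num u))) (record
    { entry = entry
    ; reach = reach′
    ; no-back = no-back′
    ; complete = complete
    })
    where
    open InInv inv using (bypass; reach; no-back)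
    alu : al u ≡ true
    alu = current-alive B Nu≡k
    no-pending : ∀ {y} → ¬ Pending u rep F y
    no-pending (uy , u≢y , a , b , ab , refl , refl) =
      none (arc-image B ab) (inj₁ (⊴⇒properAnc B (rep-alive B b) (rep-alive B a) uy u≢y))
    entry : ∀ {u₁ c x} → N u₁ ≡ suc k → (c , x) ∈ A → rep x ≡ u₁ → x ≢ u₁ → rep c ≡ u₁
    -- Vacuous: by `moved-low` nothing has been merged into the vertex numbered `suc k`.
    entry {x = x} Nu₁ _ refl x≢ =
      contradiction (≤-<-trans (moved-low B x (≢-sym x≢)) (subst (k <_) (sym Nu₁) (n<1+n k))) (<-irrefl refl)
    reach′ : ∀ {c x} → (c , x) ∈ F → LeadsTo x (rep x)
    reach′ cx with reach cx
    ... | inj₁ leads = leads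
    ... | inj₂ (pending , _) = contradiction pending no-pending
    no-back′ : ∀ {a b} → (a , b) ∈ F → N (rep b) < suc k → ¬ rep b ⊴ a
    no-back′ {a} {b} ab (s≤s le) ba with N (rep b) ℕₚ.≟ k
    ... | no ≢k = [ (λ ¬ba → ¬ba ba) , no-pending ]′ (no-back ab (ℕₚ.≤∧≢⇒< le ≢k))
    ... | yes ≡k with N-injective (trans ≡k (sym Nu≡k))
    -- An arc into `u` left over from its subtree would be a loop or a back arc, and both kinds are
    -- exhausted.
    ...   | refl with rep a ≟ rep b
    ...     | yes ra≡rb = none (arc-image B ab) (inj₂ ra≡rb)
    ...     | no ra≢rb = no-pending (rep-low B alu ba , ≢-sym ra≢rb , a , b , ab , refl , refl)
    complete : suc k ≡ n → ∀ {v} → al v ≡ true → v ≡ s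
    complete k+1≡n {v} alv with u ≟ s
    -- If `u` were not the root, its parent would need a number of at least `n`.
    ... | no u≢s = contradiction
      (<-≤-trans (toℕ<n (num (p u))) (subst (_≤ N (p u)) k+1≡n (subst (λ m → suc m ≤ N (p u)) Nu≡k (num-up u u≢s))))
      (<-irrefl refl)
    ... | yes refl with v ≟ s
    ...   | yes v≡s = v≡s
    -- With `u` the root, `bypass` would give a path from `s` that avoids `s`.
    ...   | no v≢s = contradiction (bypass alv (start-anc num num-up v) (≢-sym v≢s) self (≢-sym v≢s)) ¬av-start
    B′ : Base _ _ _ (suc k) (suc k) rep F
    B′ = record
      { rep-alive = rep-alive B
      ; rep-fix = rep-fix B
      ; rep-anc = rep-anc B
      ; rep-low = rep-low B
      ; par-rep = par-rep B
      ; arcs-map = arcs-map B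
      ; F⊆A = F⊆A B
      ; closed = λ ab → relax (closed B ab)
      ; moved-low = λ x neq → ≤-trans (moved-low B x neq) (n≤1+n k)
      ; dead-av = dead-av B
      ; late-tail = late-tail B
      }
      where
      relax : ∀ {a b} → (a , b) ∈ F ⊎ Closed k rep a b → (a , b) ∈ F ⊎ Closed (suc k) rep a b
      relax (inj₁ ab) = inj₁ ab
      relax (inj₂ ((w , le , ws) , rr)) = inj₂ ((w , ≤-trans le (n≤1+n k) , ws) , rr)

  -- Initial state, reachable states and progress.

  initial : Inv (gdInit G p)
  initial = mkInv B₀ in-arc₀ L₀ z≤n (record
    { entry = λ { _ _ refl x≢x → contradiction refl x≢x }
    ; reach = λ _ _ av → av
    ; no-back = λ _ ()
    ; complete = λ { refl → contradiction nontrivial (λ ()) }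
    })
    where
    B₀ : Base (λ _ → true) p A 0 0 id A
    B₀ = record
      { rep-alive = λ _ → refl
      ; rep-fix = λ _ → refl
      ; rep-anc = λ _ → self
      ; rep-low = λ _ yx → yx
      ; par-rep = λ _ → refl
      ; arcs-map = sym (map-id A)
      ; F⊆A = id
      ; closed = inj₁
      ; moved-low = λ _ x≢x → contradiction refl x≢x
      ; dead-av = λ ()
      ; late-tail = λ _ ()
      }
    in-arc₀ : InArc (λ _ → true) id A
    in-arc₀ {v} _ v≢s = p v , v , tree-arc v≢s , refl ,
      λ v⊴pv → <-irrefl refl (<-≤-trans (num-up v v≢s) (⊴-N v⊴pv))
    L₀ : Labels (λ _ → true) (λ x → x ∷ []) (λ _ → nothing)
    L₀ = record
      { same-idom = λ { (here refl) idom → idom }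
      ; covered = λ {w} w≢s → inj₂ (w , refl , w≢s , here refl)
      }

  reachable-inv : ∀ {st st′} → Inv st → Star Step st st′ → Inv st′
  reachable-inv inv ε = inv
  reachable-inv inv (next ◅ steps) = reachable-inv (preserve inv next) steps

  hasArcInto? : ∀ E v → Dec (HasArcInto E v)
  hasArcInto? E v with any? (λ (e : Arc n) → proj₂ e ≟ v) E
  ... | no none = no (λ (x , xv) → none (lose xv refl))
  ... | yes found with find found
  ...   | (x , _) , xv , refl = yes (x , xv)

  Resolved : GDState n → Set
  Resolved st = GDState.index st ≡ n ×
    (∀ w → w ≢ s → ∃ λ x → GDState.dom st w ≡ just x × IsIdom A s w x)

  progress : ∀ {st} → Inv st → (∃ λ st′ → Step st st′) ⊎ Resolved st
  progress {mkGD al par E sm dm k ph} (mkInv B in-arc L k≤n inv) with k ℕₚ.≟ n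
  progress {mkGD al par E sm dm k inArcs} (mkInv B in-arc L k≤n inv) | yes refl =
    contradiction (toℕ<n (num (InInv.current inv))) (<-irrefl (InInv.N-current inv))
  progress {mkGD al par E sm dm k outArcs} (mkInv B in-arc L k≤n inv) | yes k≡n =
    inj₂ (k≡n , resolved)
    where
    resolved : ∀ w → w ≢ s → ∃ λ x → dm w ≡ just x × IsIdom A s w x
    resolved w w≢s with Labels.covered L w≢s
    ... | inj₁ (x , eq , idom) = x , eq , idom⇒IsIdom idom
    ... | inj₂ (v , alv , v≢s , _) = contradiction (OutInv.complete inv k≡n alv) v≢s
  progress {mkGD al par E sm dm k ph} (mkInv B in-arc L k≤n inv) | no k≢n
    with injective⇒surjective num (proj₁ numbering) (fromℕ< (ℕₚ.≤∧≢⇒< k≤n k≢n))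
  ... | u , num-u = inj₁ (advance ph B)
    where
    Nu≡k : N u ≡ k
    Nu≡k = trans (cong toℕ num-u) (toℕ-fromℕ< (ℕₚ.≤∧≢⇒< k≤n k≢n))
    advance : ∀ ph {b rep F} → Base al par E k b rep F → ∃ λ st′ → Step (mkGD al par E sm dm k ph) st′
    advance outArcs B
      with any? (λ (e : Arc n) → proj₁ e ≟ u ×-dec treeOrForward? B u (proj₂ e)) E
    ... | no none = _ , outDone Nu≡k (λ e form → none (lose e (refl , form)))
    ... | yes found with find found
    ...   | (_ , y) , e , refl , form with hasArcInto? (E ─ e) y | u ≟ par y
    ...     | yes more | _ = _ , markOut-keep Nu≡k e form more
    ...     | no last | yes u≡py = _ , markOut-tree Nu≡k e form last u≡py
    ...     | no last | no u≢py = _ , markOut-fwd Nu≡k e form last u≢py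
    advance inArcs B
      with any? (λ (e : Arc n) → proj₂ e ≟ u ×-dec (properAnc? B u (proj₁ e) ⊎-dec (proj₁ e ≟ u))) E
    ... | no none = _ , inDone Nu≡k (λ e form → none (lose e (refl , form)))
    ... | yes found with find found
    ...   | _ , e , refl , inj₂ refl = _ , inLoop Nu≡k e
    ...   | (x , _) , e , refl , inj₁ back with properAnc⇒⊴ B back
    ...     | x≢s , u⊴px = _ , inBack Nu≡k e back
      (λ { refl → par-≢ B x≢s (⊴-antisym (par-anc B x≢s) u⊴px) })

  -- Termination.

  count : (Fin n → Bool) → List (Fin n) → ℕ
  count al [] = 0
  count al (x ∷ xs) = (if al x then 1 else 0) + count al xs

  count-≤ : ∀ al v xs → count (upd al v false) xs ≤ count al xs
  count-≤ al v [] = z≤n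
  count-≤ al v (x ∷ xs) with x ≟ v
  ... | yes _ = ≤-trans (count-≤ al v xs) (ℕₚ.m≤n+m _ _)
  ... | no _ = ℕₚ.+-monoʳ-≤ (if al x then 1 else 0) (count-≤ al v xs)

  count-< : ∀ al {v xs} → al v ≡ true → v ∈ xs → count (upd al v false) xs < count al xs
  count-< al {v} {x ∷ xs} alv (here refl) with x ≟ x
  ... | no x≢x = contradiction refl x≢x
  ... | yes _ rewrite alv = s≤s (count-≤ al v xs)
  count-< al {v} {x ∷ xs} alv (there v∈) with x ≟ v
  ... | yes _ = <-≤-trans (count-< al alv v∈) (ℕₚ.m≤n+m _ _)
  ... | no _ = ℕₚ.+-monoʳ-< (if al x then 1 else 0) (count-< al alv v∈)

  -- One more than the number of loop ends still to come, two for each unprocessed vertex.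
  pending-phases : Phase → ℕ → ℕ
  pending-phases outArcs k = suc ((n ∸ k) + (n ∸ k))
  pending-phases inArcs  k = (n ∸ k) + (n ∸ k)

  -- Loop ends to come, unmarked arcs and survivors: a phase change lowers the first, marking the
  -- second, and a contraction along a back arc the third, while no step raises any of them.
  measure : GDState n → ℕ
  measure (mkGD al par E sm dm k ph) = pending-phases ph k + (length E + count al (allFin n))

  decrease : ∀ {st st′} → Inv st → Step st st′ → measure st′ < measure st
  decrease _ (markOut-keep {al = al} {k = k} _ e _ _) =
    ℕₚ.+-monoʳ-< (pending-phases outArcs k) (ℕₚ.+-monoˡ-< (count al (allFin n)) (─-< e))
  decrease inv (markOut-tree {al = al} {par = par} {E = E} {k = k} {v = v} _ e _ _ _) =
    ℕₚ.+-monoʳ-< (pending-phases outArcs k)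
      (ℕₚ.+-mono-<-≤ (subst (_< length E) (sym (length-map _ (E ─ e))) (─-< e)) (count-≤ al v (allFin n)))
  decrease inv (markOut-fwd {al = al} {par = par} {E = E} {k = k} {v = v} _ e _ _ _) =
    ℕₚ.+-monoʳ-< (pending-phases outArcs k)
      (ℕₚ.+-mono-<-≤ (subst (_< length E) (sym (length-map _ (E ─ e))) (─-< e)) (count-≤ al v (allFin n)))
  decrease _ (outDone _ _) = ≤-refl
  decrease _ (inLoop {al = al} {k = k} _ e) =
    ℕₚ.+-monoʳ-< (pending-phases inArcs k) (ℕₚ.+-monoˡ-< (count al (allFin n)) (─-< e))
  decrease inv (inBack {al = al} {E = E} {k = k} {v = v} _ arc _ _) =
    ℕₚ.+-monoʳ-< (pending-phases inArcs k)
      (ℕₚ.+-mono-≤-< (ℕₚ.≤-reflexive (length-map _ E))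
        (count-< al (tail-alive (Inv.base inv) arc) (∈-allFin v)))
  decrease _ (inDone {al = al} {E = E} {k = k} {u = u} Nu≡k _) =
    ℕₚ.+-monoˡ-< (length E + count al (allFin n)) (fewer (subst (_< n) Nu≡k (toℕ<n (num u))))
    where
    fewer : k < n → suc ((n ∸ suc k) + (n ∸ suc k)) < (n ∸ k) + (n ∸ k)
    fewer k<n rewrite ℕₚ.+-∸-assoc 1 k<n =
      s≤s (subst (suc (n ∸ suc k + (n ∸ suc k)) ≤_) (sym (ℕₚ.+-suc _ _)) ≤-refl)

  terminates : ∀ {st} → Inv st → Acc (λ st′ st → Step st st′) st
  terminates {st} inv = go inv (<-wellFounded (measure st))
    where
    go : ∀ {st} → Inv st → Acc _<_ (measure st) → Acc (λ st′ st → Step st st′) st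
    go inv (acc rs) = acc (λ next → go (preserve inv next) (rs (decrease inv next)))

theorem6 : ∀ {n} (G : FlowGraph n) (p : Fin n → Fin n) (num : Fin n → Fin n) →
    IsDFSTree G p → IsBottomUpNumbering (FlowGraph.start G) p num →
    Acc (λ st' st → GDStep (FlowGraph.start G) num st st') (gdInit G p) ×
    (∀ st → Star (GDStep (FlowGraph.start G) num) (gdInit G p) st →
    (∃ λ st' → GDStep (FlowGraph.start G) num st st') ⊎
    (GDState.index st ≡ n ×
    (∀ w → w ≢ FlowGraph.start G →
    ∃ λ x → GDState.dom st w ≡ just x × IsIdom (FlowGraph.arcs G) (FlowGraph.start G) w x)))
theorem6 G p num tree numbering =
  terminates initial , λ st steps → progress (reachable-inv initial steps)
  where
  open Contraction G p num numbering (DepthFirst.ranking G p tree)
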